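{- There is a function $g:\mathbb{N}\to\mathbb{R}$ with $g(n)/n^2\to 0$ as $n\to\infty$ such that the following holds. Let $G$ be a triangle-free graph on $n$ vertices, where $n$ is divisible by $3$. Then there exists a partition $V(G)=A_1\cup A_2\cup A_3$ with $|A_1|=|A_2|=|A_3|=n/3$ such that $e(A_i)\leq n^2/48+g(n)$ for each $i\in\{1,2,3\}$.
   Context: For $S\subseteq V(G)$, $e(S)$ denotes the number of edges of $G$ with both endpoints in $S$. -}

module Defs where

open import Data.Nat using (ℕ; suc; _+_; _*_; _≤_; _<ᵇ_)
open import Data.Nat.Divisibility using (_∣_)
open import Data.Bool using (Bool; true; false; _∧_)
open import Data.Fin using (Fin; toℕ; _≟_)
open import Data.List using (List; length; filterᵇ; allFin; map)
open import Data.Nat.ListAction using (sum)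
open import Data.Product using (Σ; ∃; _×_)
open import Data.Empty using (⊥)
open import Relation.Nullary.Decidable using (⌊_⌋)
open import Relation.Binary.PropositionalEquality using (_≡_)

record Graph (n : ℕ) : Set where
  field
    adj    : Fin n → Fin n → Bool
    sym    : ∀ i j → adj i j ≡ adj j i
    irrefl : ∀ i → adj i i ≡ false
open Graph public

TriangleFree : ∀ {n} → Graph n → Set
TriangleFree G = ∀ i j k → adj G i j ≡ true → adj G j k ≡ true → adj G i k ≡ true → ⊥

card : ∀ {n} → (Fin n → Bool) → ℕ
card {n} S = length (filterᵇ S (allFin n))

e : ∀ {n} → Graph n → (Fin n → Bool) → ℕ
e {n} G S = sum (map (λ i → card (λ j → (toℕ i <ᵇ toℕ j) ∧ S i ∧ S j ∧ adj G i j)) (allFin n))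

part : ∀ {n} → (Fin n → Fin 3) → Fin 3 → (Fin n → Bool)
part p k v = ⌊ p v ≟ k ⌋

-- g(n)/n² → 0 (g ℕ-valued): for every k ≥ 1 eventually (k) · g(n) ≤ n²
LittleOSquare : (ℕ → ℕ) → Set
LittleOSquare g = ∀ k → ∃ λ N → ∀ n → N ≤ n → suc k * g n ≤ n * n

{-# OPTIONS --safe #-}
module Submission where

-- It suffices to find S of size n/3 with e(S) ≤ n²/48 and e(V ∖ S) ≤ n²/12, up
-- to O(n^{3/2}): a proportional sample of half of V ∖ S then splits the rest
-- into two parts with a quarter of its edges each.  Proportional samples, of
-- any size and inside any vertex set, come from a greedy (Steinitz type)
-- argument in place of randomness.
--
-- If e ≤ 3n²/16, a proportional sample of V serves as S.  If some d(v) ≥ 2n/3,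
-- take S ⊇ V ∖ N(v), filled up by a sample of N(v).  Otherwise let D(v) be the
-- sum of the degrees of the neighbours of v.  Since Σ D(v) = Σ d(v)², some v
-- has d(v)² − D(v) below a suitable linear function of d(v) that vanishes at
-- the average degree.  For this v take S as a sample of N(v) if d(v) ≥ n/3, and
-- else N(v) filled up by a sample of V ∖ N(v).

open import Defs renaming (sym to adj-sym; irrefl to adj-irrefl)
open import Data.Bool as Bool using (Bool; true; false; _∧_; _∨_; not; if_then_else_)
open import Data.Bool.Properties using () renaming (_≟_ to _≟ᵇ_)
open import Data.Empty using (⊥; ⊥-elim)
open import Data.Fin using (Fin; zero; suc; toℕ; _≟_)
open import Data.Fin.Properties using (any?; toℕ-injective)
open import Data.Integer using (ℤ; +_; -[1+_]; -_; _+_; _*_; _-_; ∣_∣; _≤_; _<_; 0ℤ; 1ℤ; +≤+; +<+; positive; nonNegative)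
open import Data.Integer.Properties hiding (_≟_)
open import Data.Integer.Tactic.RingSolver using (solve-∀)
open import Data.List using (tabulate; filterᵇ; length; map)
import Data.Nat.ListAction as List
open import Data.Nat as ℕ using (ℕ; zero; suc; z≤n; s≤s)
open import Data.Nat.Divisibility using (_∣_; divides)
import Data.Nat.Properties as ℕ
import Data.Nat.Tactic.RingSolver as ℕR
open import Data.Product using (∃; Σ; _×_; _,_; proj₁; proj₂)
open import Relation.Nullary using (yes; no; does; contradiction)
open import Relation.Nullary.Decidable using (_×-dec_)
open import Relation.Binary.PropositionalEquality hiding (J)
open import Algebra.Properties.Semiring.Sum +-*-semiring
  using (sum; sum-cong-≗; ∑-distrib-+; ∑-comm; *-distribˡ-sum; sum-replicate-zero)

-- Integers and finite sums

-- The constants come from the complete bipartite graph with two classes of size n/2. A proportional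
-- partition into three puts about e/9 edges into each part, which is at most n²/48 exactly when e ≤
-- 3n²/16; on this graph it gives n²/36, so one part has to follow the structure of the graph. If S
-- consists of n/3 vertices of one class, it spans no edge, and the rest consists of n/6 against n/2
-- vertices, hence n²/12 edges, a quarter of which is n²/48. The budget n²/12 has no slack here, so
-- the inequalities that produce S from a neighbourhood must hold with equality on this graph; `gap`
-- vanishes on it. The real numbers are avoided by clearing denominators. Most polynomial
-- inequalities are settled by a certificate: an explicit sum of nonnegative terms, built from
-- hypotheses and squares, which the ring solver identifies with the difference of the two sides.

≤-from : ∀ {x y} c → 0ℤ ≤ c → c ≡ y - x → x ≤ y
≤-from c 0≤c eq = 0≤i-j⇒j≤i (subst (0ℤ ≤_) eq 0≤c)

0≤+ : ∀ {x y} → 0ℤ ≤ x → 0ℤ ≤ y → 0ℤ ≤ x + y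
0≤+ = +-mono-≤

0≤* : ∀ {x y} → 0ℤ ≤ x → 0ℤ ≤ y → 0ℤ ≤ x * y
0≤* {x} {y} 0≤x 0≤y =
  subst (_≤ x * y) (*-zeroʳ x) (*-monoˡ-≤-nonNeg x {{nonNegative 0≤x}} 0≤y)

0≤sq : ∀ x → 0ℤ ≤ x * x
0≤sq (+ n)            = subst (0ℤ ≤_) (pos-* n n) (+≤+ z≤n)
0≤sq -[1+ n ] = +≤+ z≤n

0≤+n : ∀ {n} → 0ℤ ≤ + n
0≤+n = +≤+ z≤n

0<* : ∀ {x y} → 0ℤ < x → 0ℤ < y → 0ℤ < x * y
0<* {x} {y} 0<x 0<y =
  subst (_< x * y) (*-zeroʳ x) (*-monoˡ-<-pos x {{positive 0<x}} 0<y)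

*-cancelˡ-≤ : ∀ {x y} k → 0ℤ < k → k * x ≤ k * y → x ≤ y
*-cancelˡ-≤ {x} {y} k 0<k = *-cancelˡ-≤-pos x y k {{positive 0<k}}

*-monoˡ-≤ : ∀ {x y} k → 0ℤ ≤ k → x ≤ y → k * x ≤ k * y
*-monoˡ-≤ k 0≤k = *-monoˡ-≤-nonNeg k {{nonNegative 0≤k}}

0≤∸ : ∀ {x y} → x ≤ y → 0ℤ ≤ y - x
0≤∸ = i≤j⇒0≤j-i

0<+ : ∀ {k} → 0ℤ < + suc k
0<+ = +<+ (s≤s z≤n)

-- Brings an equation such as n = 3h into a certificate: a multiple of the vanishing difference is
-- added as one more nonnegative summand, so that the identity holds for independent n and h.
0≤-zero : ∀ {x y} k → x ≡ y → 0ℤ ≤ k * (x - y)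
0≤-zero {x} k refl = ≤-reflexive (sym (trans (cong (_*_ k) (+-inverseʳ x)) (*-zeroʳ k)))

sum-lin₂ : ∀ {n} a b (f g : Fin n → ℤ) →
  sum (λ i → a * f i + b * g i) ≡ a * sum f + b * sum g
sum-lin₂ a b f g = trans (∑-distrib-+ (λ i → a * f i) (λ i → b * g i))
  (cong₂ _+_ (sym (*-distribˡ-sum a f)) (sym (*-distribˡ-sum b g)))

sum-lin₃ : ∀ {n} a b c (f g h : Fin n → ℤ) →
  sum (λ i → a * f i + b * g i + c * h i) ≡ a * sum f + b * sum g + c * sum h
sum-lin₃ a b c f g h = trans (∑-distrib-+ (λ i → a * f i + b * g i) (λ i → c * h i))
  (cong₂ _+_ (sum-lin₂ a b f g) (sym (*-distribˡ-sum c h)))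

sum-mono : ∀ {n} {f g : Fin n → ℤ} → (∀ i → f i ≤ g i) → sum f ≤ sum g
sum-mono {zero}  f≤g = ≤-refl
sum-mono {suc n} f≤g = +-mono-≤ (f≤g zero) (sum-mono (λ i → f≤g (suc i)))

sum-0≤ : ∀ {n} {f : Fin n → ℤ} → (∀ i → 0ℤ ≤ f i) → 0ℤ ≤ sum f
sum-0≤ {n} {f} 0≤f = subst (_≤ sum f) (sum-replicate-zero n) (sum-mono 0≤f)

sum-≤0 : ∀ {n} {f : Fin n → ℤ} → (∀ i → f i ≤ 0ℤ) → sum f ≤ 0ℤ
sum-≤0 {n} {f} f≤0 = subst (sum f ≤_) (sum-replicate-zero n) (sum-mono f≤0)

sum-const : ∀ {n} c → sum {n} (λ _ → c) ≡ + n * c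
sum-const {zero}  c = sym (*-zeroˡ c)
sum-const {suc n} c = trans (cong (_+_ c) (sum-const {n} c)) (lem (+ n) c)
  where
  lem : ∀ x c → c + x * c ≡ (1ℤ + x) * c
  lem = solve-∀

-- Subsets

ι : Bool → ℤ
ι true  = 1ℤ
ι false = 0ℤ

Subset : ℕ → Set
Subset n = Fin n → Bool

_⊆_ : ∀ {n} → Subset n → Subset n → Set
P ⊆ X = ∀ v → P v ≡ true → X v ≡ true

full : ∀ {n} → Subset n
full _ = true

_∖_ : ∀ {n} → Subset n → Subset n → Subset n
(X ∖ P) v = X v ∧ not (P v)

_∪_ : ∀ {n} → Subset n → Subset n → Subset n
(X ∪ P) v = X v ∨ P v

χ : ∀ {n} → Subset n → Fin n → ℤ
χ S v = ι (S v)

# : ∀ {n} → Subset n → ℤ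
# S = sum (χ S)

0≤ι : ∀ b → 0ℤ ≤ ι b
0≤ι true  = +≤+ z≤n
0≤ι false = +≤+ z≤n

ι≤1 : ∀ b → ι b ≤ 1ℤ
ι≤1 true  = ≤-refl
ι≤1 false = +≤+ z≤n

χ-mono : ∀ {n} {P X : Subset n} → P ⊆ X → ∀ v → χ P v ≤ χ X v
χ-mono {P = P} {X} P⊆X v with P v | P⊆X v
... | true  | t = subst (λ b → 1ℤ ≤ ι b) (sym (t refl)) ≤-refl
... | false | _ = 0≤ι (X v)

χ-∖ : ∀ {n} {P X : Subset n} → P ⊆ X → ∀ v → χ (X ∖ P) v ≡ χ X v - χ P v
χ-∖ {P = P} {X} P⊆X v with P v | X v | P⊆X v
... | true  | true  | _ = refl
... | true  | false | t = contradiction (t refl) λ ()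
... | false | true  | _ = refl
... | false | false | _ = refl

χ-∪ : ∀ {n} {P X : Subset n} → (∀ v → X v ≡ true → P v ≡ false) → ∀ v → χ (X ∪ P) v ≡ χ X v + χ P v
χ-∪ {P = P} {X} disj v with X v | P v | disj v
... | true  | true  | t = contradiction (t refl) λ ()
... | true  | false | _ = refl
... | false | true  | _ = refl
... | false | false | _ = refl

sum-minus : ∀ {n} (f g : Fin n → ℤ) → sum (λ i → f i - g i) ≡ sum f - sum g
sum-minus f g = trans (sum-cong-≗ λ i → lem (f i) (g i)) (trans (sum-lin₂ 1ℤ (- 1ℤ) f g) (sym (lem (sum f) (sum g))))
  where
  lem : ∀ x y → x - y ≡ 1ℤ * x + - 1ℤ * y
  lem = solve-∀

#-∖ : ∀ {n} {P X : Subset n} → P ⊆ X → # (X ∖ P) ≡ # X - # P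
#-∖ {P = P} {X} P⊆X = trans (sum-cong-≗ (χ-∖ P⊆X)) (sum-minus (χ X) (χ P))

#-∪ : ∀ {n} {P X : Subset n} → (∀ v → X v ≡ true → P v ≡ false) → # (X ∪ P) ≡ # X + # P
#-∪ {P = P} {X} disj = trans (sum-cong-≗ (χ-∪ disj)) (∑-distrib-+ (χ X) (χ P))

0≤# : ∀ {n} (S : Subset n) → 0ℤ ≤ # S
0≤# S = sum-0≤ (λ v → 0≤ι (S v))

#-full : ∀ {n} → # {n} full ≡ + n
#-full {n} = trans (sum-const {n} 1ℤ) (*-identityʳ (+ n))

#-mono : ∀ {n} {P X : Subset n} → P ⊆ X → # P ≤ # X
#-mono P⊆X = sum-mono (χ-mono P⊆X)

#≤n : ∀ {n} (S : Subset n) → # S ≤ + n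
#≤n S = subst (# S ≤_) #-full (#-mono {P = S} {full} (λ _ _ → refl))

-- Averaging by integrality: if g were positive on all of S, it would be at least 1 there, and the
-- sum at least the size of S.
∃-nonpos : ∀ {n} (S : Subset n) (g : Fin n → ℤ) → 0ℤ < # S →
  sum (λ v → χ S v * g v) ≤ 0ℤ → ∃ λ v → S v ≡ true × g v ≤ 0ℤ
∃-nonpos S g 0<S s≤0 with any? (λ v → (S v ≟ᵇ true) ×-dec (g v ≤? 0ℤ))
... | yes found = found
... | no  none  = contradiction (≤-trans (sum-mono bound) s≤0) (<⇒≱ 0<S)
  where
  bound : ∀ v → χ S v ≤ χ S v * g v
  bound v with S v in eq
  ... | true  = subst (1ℤ ≤_) (sym (*-identityˡ (g v)))
                  (i<j⇒suc[i]≤j (≰⇒> λ g≤0 → none (v , eq , g≤0)))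
  ... | false = ≤-refl

-- Polynomial inequalities

-- d is the degree of a vertex, D the sum of the degrees of its neighbours, and
-- n² − U four times the number of edges.  Over all vertices d² − D and
-- 2nd − n² + U = 2n(d − average degree) sum to zero.  The slope 8n² + 15U keeps
-- the discriminants in gap-high and gap-middle nonpositive for 4U ≤ n², and is
-- large enough to exclude very small d in gap-low.
gap : ℤ → ℤ → ℤ → ℤ → ℤ
gap n U d D = + 32 * n * n * (d * d - D) - (+ 8 * n * n + + 15 * U) * (+ 2 * n * d - n * n + U)

module _ {n U d D : ℤ} (0<n : 0ℤ < n) (0≤U : 0ℤ ≤ U) (4U≤n² : + 4 * U ≤ n * n) (gap≤0 : gap n U d D ≤ 0ℤ) where

  private
    0≤n = <⇒≤ 0<n
    0≤v = 0≤∸ 4U≤n²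
    0≤-gap = 0≤∸ gap≤0

  -- Eliminating D through `gap` leaves a quadratic in d, whose square the certificate completes.
  -- Equality holds for U = 0, d = n/2, D = n²/4, the balanced complete bipartite graph. With U = n²
  -- - 2M the factor 2n² - 3U is 6M - n², the form that `inside-N` takes.
  gap-high : d * (+ 2 * (n * n) - + 3 * U) ≤ + 4 * n * D
  gap-high = *-cancelˡ-≤ (+ 256 * n) (0<* (0<+ {255}) 0<n) (≤-from _
    (0≤+ (0≤+ (0≤* (0≤+n {32}) 0≤-gap) (0≤sq (+ 32 * n * d - + 16 * n * n - + 3 * U)))
         (0≤* 0≤U (0≤+ (0≤* (0≤+n {128}) 0≤v) (0≤* (0≤+n {23}) 0≤U))))
    (cert n U d D))
    where
    cert : ∀ n U d D →
      + 32 * (0ℤ - (+ 32 * n * n * (d * d - D) - (+ 8 * n * n + + 15 * U) * (+ 2 * n * d - n * n + U)))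
      + (+ 32 * n * d - + 16 * n * n - + 3 * U) * (+ 32 * n * d - + 16 * n * n - + 3 * U)
      + U * (+ 128 * (n * n - + 4 * U) + + 23 * U)
      ≡ + 256 * n * (+ 4 * n * D) - + 256 * n * (d * (+ 2 * (n * n) - + 3 * U))
    cert = solve-∀

  -- Again a completed square in d. With U = n² - 2M it says that V ∖ N(v), of size b = n - d, spans
  -- at most 3b²/16 edges: the density at which 2n/3 sampled vertices carry n²/12.
  gap-middle : + 4 * (n * n) - + 4 * U - + 3 * ((n - d) * (n - d)) ≤ + 16 * D
  gap-middle = *-cancelˡ-≤ (+ 304 * (n * n)) (0<* (0<+ {303}) (0<* 0<n 0<n)) (≤-from _
    (0≤+ (0≤+ (0≤+ (0≤* (0≤+n {152}) 0≤-gap) (0≤sq (+ 76 * n * d - + 28 * n * n - + 30 * U)))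
         (0≤* (0≤sq n) (0≤+ (0≤* (0≤+n {128}) 0≤v) (0≤* (0≤+n {317}) 0≤U))))
         (0≤* (0≤* (0≤+n {795}) 0≤U) 0≤v))
    (cert n U d D))
    where
    cert : ∀ n U d D →
      + 152 * (0ℤ - (+ 32 * n * n * (d * d - D) - (+ 8 * n * n + + 15 * U) * (+ 2 * n * d - n * n + U)))
      + (+ 76 * n * d - + 28 * n * n - + 30 * U) * (+ 76 * n * d - + 28 * n * n - + 30 * U)
      + n * n * (+ 128 * (n * n - + 4 * U) + + 317 * U) + + 795 * U * (n * n - + 4 * U)
      ≡ + 304 * (n * n) * (+ 16 * D) - + 304 * (n * n) * (+ 4 * (n * n) - + 4 * U - + 3 * ((n - d) * (n - d)))
    cert = solve-∀

  -- For a degree this far below the average the linear term of `gap` contributes a large positive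
  -- amount, and 3D ≤ 2nd keeps d² - D from cancelling it. The certificate makes -96w² nonnegative,
  -- where w > 0 is the slack in the degree hypothesis.
  gap-low : + 3 * D ≤ + 2 * n * d → + 16 * n * d < + 4 * (n * n) - U → ⊥
  gap-low 3D≤2nd low = <⇒≱ (0<* (0<+ {95}) (0<* 0<w 0<w)) (≤-from _
    (0≤+ (0≤+ (0≤+ (0≤+ (0≤* (0≤+n {768}) 0≤-gap) (0≤* (0≤* (0≤+n {8192}) (0≤sq n)) (0≤∸ 3D≤2nd)))
      (0≤* (0≤sq n) (0≤+ (0≤* (0≤+n {512}) 0≤v) (0≤* (0≤+n {192}) 0≤U))))
      (0≤* (0≤* (0≤+n {2496}) 0≤U) 0≤v))
      (0≤* (<⇒≤ 0<w) (0≤+ (0≤* (0≤+n {1024}) (0≤sq n)) (0≤* (0≤+n {1632}) 0≤U))))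
    (cert n U d D))
    where
    w = + 4 * (n * n) - U - + 16 * n * d
    0<w : 0ℤ < w
    0<w = subst (_< w) (+-inverseʳ (+ 16 * n * d)) (+-monoˡ-< (- (+ 16 * n * d)) low)
    cert : ∀ n U d D →
      + 768 * (0ℤ - (+ 32 * n * n * (d * d - D) - (+ 8 * n * n + + 15 * U) * (+ 2 * n * d - n * n + U)))
      + + 8192 * (n * n) * (+ 2 * n * d - + 3 * D)
      + n * n * (+ 512 * (n * n - + 4 * U) + + 192 * U) + + 2496 * U * (n * n - + 4 * U)
      + (+ 4 * (n * n) - U - + 16 * n * d) * (+ 1024 * (n * n) + + 1632 * U)
      ≡ 0ℤ - + 96 * ((+ 4 * (n * n) - U - + 16 * n * d) * (+ 4 * (n * n) - U - + 16 * n * d))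
    cert = solve-∀

-- Bounds the edges inside N(v) ∪ T in around-N; n − 3d is three times the size
-- of T.
low-degree-bound : ∀ {n U d D} → 0ℤ < n → + 4 * U ≤ n * n → + 3 * d ≤ n →
  + 4 * (n * n) - U ≤ + 16 * n * d → + 3 * D ≤ + 2 * n * d →
  + 4 * ((n - + 3 * d) * (n - + 3 * d)) * (n * n - U) + + 32 * n * (n - + 3 * d) * D
    ≤ + 3 * (n * n) * ((n - d) * (n - d))
low-degree-bound {n} {U} {d} {D} 0<n 4U≤n² 3d≤n low 3D≤2nd =
  *-cancelˡ-≤ (+ 3) (0<+ {2}) (≤-from _
    (0≤+ (0≤+ (0≤* (0≤* (0≤+n {12}) (0≤sq θ)) (0≤∸ low))
              (0≤* (0≤* (0≤* (0≤+n {32}) 0≤n) 0≤θ) (0≤∸ 3D≤2nd)))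
         (0≤* 0≤n (0≤∸ cubic)))
    (cert₂ n U d D θ (n - d)))
  where
  0≤n = <⇒≤ 0<n
  θ = n - + 3 * d
  w = + 3 * n - + 10 * θ
  0≤θ = 0≤∸ 3d≤n
  10θ≤3n : + 10 * θ ≤ + 3 * n
  10θ≤3n = *-cancelˡ-≤ (+ 64 * n) (0<* (0<+ {63}) 0<n) (≤-from _
    (0≤+ (0≤+ (0≤* (0≤+n {120}) (0≤∸ low)) (0≤* (0≤+n {30}) (0≤∸ 4U≤n²))) (0≤* (0≤+n {2}) (0≤sq n)))
    (cert n U d))
    where
    cert : ∀ n U d →
      + 120 * (+ 16 * n * d - (+ 4 * (n * n) - U)) + + 30 * (n * n - + 4 * U) + + 2 * (n * n)
      ≡ + 64 * n * (+ 3 * n) - + 64 * n * (+ 10 * (n - + 3 * d))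
    cert = solve-∀
  0≤w = 0≤∸ 10θ≤3n
  cubic : + 12 * (θ * θ) * (+ 16 * d - + 3 * n) + + 64 * n * θ * d ≤ + 9 * n * ((n - d) * (n - d))
  cubic = *-cancelˡ-≤ (+ 150) (0<+ {149}) (≤-from _
    (0≤+ (0≤* (0≤* (0≤+n {96}) 0≤θ) (0≤sq w))
         (0≤* 0≤n (0≤+ (0≤+ (0≤* 0≤w (0≤+ (0≤* (0≤+n {49}) 0≤w) (0≤* (0≤+n {53}) 0≤n)))
            (0≤* (0≤+n {6}) (0≤* 0≤n 0≤θ))) (0≤* (0≤+n {10}) (0≤sq θ)))))
    (cert₁ n d))
    where
    cert₁ : ∀ n d → let θ = n - + 3 * d; w = + 3 * n - + 10 * θ in
      + 96 * θ * (w * w) + n * (w * (+ 49 * w + + 53 * n) + + 6 * (n * θ) + + 10 * (θ * θ))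
      ≡ + 150 * (+ 9 * n * ((n - d) * (n - d)))
        - + 150 * (+ 12 * (θ * θ) * (+ 16 * d - + 3 * n) + + 64 * n * θ * d)
    cert₁ = solve-∀
  cert₂ : ∀ n U d D θ b →
    + 12 * (θ * θ) * (+ 16 * n * d - (+ 4 * (n * n) - U)) + + 32 * n * θ * (+ 2 * n * d - + 3 * D)
    + n * (+ 9 * n * (b * b) - (+ 12 * (θ * θ) * (+ 16 * d - + 3 * n) + + 64 * n * θ * d))
    ≡ + 3 * (+ 3 * (n * n) * (b * b)) - + 3 * (+ 4 * (θ * θ) * (n * n - U) + + 32 * n * θ * D)
  cert₂ = solve-∀

-- Edge counts and proportional samples

sum-singleton : ∀ {n} (x : Fin n) (f : Fin n → ℤ) → sum (λ u → ι (does (u ≟ x)) * f u) ≡ f x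
sum-singleton {suc n} zero f = trans (cong₂ _+_ (*-identityˡ (f zero)) (sum-replicate-zero n)) (+-identityʳ (f zero))
sum-singleton {suc n} (suc x) f = trans (+-identityˡ _) (sum-singleton x (λ u → f (suc u)))

singleton : ∀ {n} → Fin n → Subset n
singleton x u = does (u ≟ x)

#-singleton : ∀ {n} (x : Fin n) → # (singleton x) ≡ 1ℤ
#-singleton x = trans (sum-cong-≗ λ u → sym (*-identityʳ (ι (does (u ≟ x))))) (sum-singleton x (λ _ → 1ℤ))

module Edges {n : ℕ} (G : Graph n) where

  A : Fin n → Fin n → ℤ
  A u v = ι (adj G u v)

  A-sym : ∀ u v → A u v ≡ A v u
  A-sym u v = cong ι (adj-sym G u v)

  deg : Subset n → Fin n → ℤ
  deg S v = sum (λ u → χ S u * A u v)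

  -- E S S counts every edge inside S twice.
  E : Subset n → Subset n → ℤ
  E S W = sum (λ v → deg S v * χ W v)

  0≤χA : ∀ S u v → 0ℤ ≤ χ S u * A u v
  0≤χA S u v = 0≤* (0≤ι (S u)) (0≤ι (adj G u v))

  0≤deg : ∀ S v → 0ℤ ≤ deg S v
  0≤deg S v = sum-0≤ (λ u → 0≤χA S u v)

  deg≤# : ∀ S v → deg S v ≤ # S
  deg≤# S v = sum-mono λ u → subst (χ S u * A u v ≤_) (*-identityʳ (χ S u)) (*-monoˡ-≤ (χ S u) (0≤ι (S u)) (ι≤1 (adj G u v)))

  deg-∖ : ∀ {P X} → P ⊆ X → ∀ v → deg (X ∖ P) v ≡ deg X v - deg P v
  deg-∖ {P} {X} P⊆X v = trans (sum-cong-≗ λ u → trans (cong (_* A u v) (χ-∖ P⊆X u)) (lem (χ X u) (χ P u) (A u v)))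
    (sum-minus (λ u → χ X u * A u v) (λ u → χ P u * A u v))
    where
    lem : ∀ x p a → (x - p) * a ≡ x * a - p * a
    lem = solve-∀

  deg-∪ : ∀ {P X : Subset n} → (∀ v → X v ≡ true → P v ≡ false) → ∀ v → deg (X ∪ P) v ≡ deg X v + deg P v
  deg-∪ {P} {X} disj v = trans (sum-cong-≗ λ u → trans (cong (_* A u v) (χ-∪ disj u)) (*-distribʳ-+ (A u v) (χ X u) (χ P u)))
    (∑-distrib-+ (λ u → χ X u * A u v) (λ u → χ P u * A u v))

  E-sym : ∀ S W → E S W ≡ E W S
  E-sym S W = begin
    sum (λ v → deg S v * χ W v)                   ≡⟨ sum-cong-≗ (λ v → expand S W v) ⟩
    sum (λ v → sum (λ u → χ W v * (χ S u * A u v))) ≡⟨ ∑-comm (λ v u → χ W v * (χ S u * A u v)) ⟩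
    sum (λ u → sum (λ v → χ W v * (χ S u * A u v))) ≡⟨ sum-cong-≗ (λ u → sum-cong-≗ λ v → trans (lem (χ W v) (χ S u) (A u v)) (cong (λ a → χ S u * (χ W v * a)) (A-sym u v))) ⟩
    sum (λ u → sum (λ v → χ S u * (χ W v * A v u))) ≡⟨ sum-cong-≗ (λ v → expand W S v) ⟨
    sum (λ v → deg W v * χ S v)                   ∎
    where
    open ≡-Reasoning
    expand : ∀ S W v → deg S v * χ W v ≡ sum (λ u → χ W v * (χ S u * A u v))
    expand S W v = trans (*-comm (deg S v) (χ W v)) (*-distribˡ-sum (χ W v) (λ u → χ S u * A u v))
    lem : ∀ w s a → w * (s * a) ≡ s * (w * a)
    lem = solve-∀

  E-∖ˡ : ∀ {P X} → P ⊆ X → ∀ W → E (X ∖ P) W ≡ E X W - E P W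
  E-∖ˡ {P} {X} P⊆X W = trans (sum-cong-≗ λ v → trans (cong (_* χ W v) (deg-∖ P⊆X v)) (lem (deg X v) (deg P v) (χ W v)))
    (sum-minus (λ v → deg X v * χ W v) (λ v → deg P v * χ W v))
    where
    lem : ∀ x p a → (x - p) * a ≡ x * a - p * a
    lem = solve-∀

  E-∪ˡ : ∀ {P X : Subset n} → (∀ v → X v ≡ true → P v ≡ false) → ∀ W → E (X ∪ P) W ≡ E X W + E P W
  E-∪ˡ {P} {X} disj W = trans (sum-cong-≗ λ v → trans (cong (_* χ W v) (deg-∪ disj v)) (*-distribʳ-+ (χ W v) (deg X v) (deg P v)))
    (∑-distrib-+ (λ v → deg X v * χ W v) (λ v → deg P v * χ W v))

  0≤E : ∀ S W → 0ℤ ≤ E S W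
  0≤E S W = sum-0≤ (λ v → 0≤* (0≤deg S v) (0≤ι (W v)))

  E-monoʳ : ∀ S {W W′} → W ⊆ W′ → E S W ≤ E S W′
  E-monoʳ S W⊆W′ = sum-mono (λ v → *-monoˡ-≤ (deg S v) (0≤deg S v) (χ-mono W⊆W′ v))

  -- |X| times the deviation of deg P from its expectation (|P|/|X|) deg X for a
  -- uniformly random P.
  err : Subset n → Subset n → Fin n → ℤ
  err X P v = # X * deg P v - # P * deg X v

  ∈-∖ : ∀ {X P : Subset n} v → (X ∖ P) v ≡ true → X v ≡ true × P v ≡ false
  ∈-∖ {X} {P} v eq with X v | P v
  ... | true | false = refl , refl

  module Extend {X P : Subset n} (P⊆X : P ⊆ X) (x : Fin n) (x∈X : X x ≡ true) (x∉P : P x ≡ false) where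

    change : Fin n → ℤ
    change v = # X * A x v - deg X v

    P′ : Subset n
    P′ = P ∪ singleton x

    disj : ∀ v → P v ≡ true → singleton x v ≡ false
    disj v Pv with v ≟ x
    ... | yes refl = contradiction (trans (sym Pv) x∉P) λ ()
    ... | no  _    = refl

    P′⊆X : P′ ⊆ X
    P′⊆X v P′v with P v in Pv | v ≟ x
    ... | true  | _        = P⊆X v Pv
    ... | false | yes refl = x∈X

    #P′ : # P′ ≡ # P + 1ℤ
    #P′ = trans (#-∪ disj) (cong (_+_ (# P)) (#-singleton x))

    err′ : ∀ v → err X P′ v ≡ err X P v + change v
    err′ v = trans (cong₂ (λ a b → # X * a - b * deg X v) (trans (deg-∪ disj v) (cong (_+_ (deg P v)) (sum-singleton x (λ u → A u v)))) #P′)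
      (lem (# X) (deg P v) (A x v) (# P) (deg X v))
      where
      lem : ∀ m p a t δ → m * (p + a) - (t + 1ℤ) * δ ≡ m * p - t * δ + (m * a - δ)
      lem = solve-∀

    -- The product of the size of X with A x v is 0 or the size of X, and deg X v lies between these
    -- two values.
    change²≤ : ∀ v → change v * change v ≤ # X * # X
    change²≤ v with adj G x v
    ... | true  = ≤-from _ (0≤* (0≤deg X v) (0≤+ (0≤∸ (deg≤# X v)) (0≤# X))) (lem (# X) (deg X v))
      where
      lem : ∀ m δ → δ * (m - δ + m) ≡ m * m - (m * 1ℤ - δ) * (m * 1ℤ - δ)
      lem = solve-∀
    ... | false = ≤-from _ (0≤* (0≤∸ (deg≤# X v)) (0≤+ (0≤deg X v) (0≤# X))) (lem (# X) (deg X v))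
      where
      lem : ∀ m δ → (m - δ) * (δ + m) ≡ m * m - (m * 0ℤ - δ) * (m * 0ℤ - δ)
      lem = solve-∀

    square : ∀ v → err X P′ v * err X P′ v ≤ 1ℤ * (err X P v * err X P v) + + 2 * (err X P v * change v) + (# X * # X) * 1ℤ
    square v = subst (λ z → z * z ≤ 1ℤ * (err X P v * err X P v) + + 2 * (err X P v * change v) + (# X * # X) * 1ℤ)
      (sym (err′ v)) (≤-from _ (0≤∸ (change²≤ v)) (lem (err X P v) (change v) (# X)))
      where
      lem : ∀ e w m → m * m - w * w ≡ 1ℤ * (e * e) + + 2 * (e * w) + (m * m) * 1ℤ - (e + w) * (e + w)
      lem = solve-∀

    bound : sum (λ v → err X P v * change v) ≤ 0ℤ →
      sum (λ v → err X P′ v * err X P′ v) ≤ sum (λ v → err X P v * err X P v) + + n * (# X * # X)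
    bound g≤0 = begin
      sum (λ v → err X P′ v * err X P′ v)
        ≤⟨ sum-mono square ⟩
      sum (λ v → 1ℤ * (err X P v * err X P v) + + 2 * (err X P v * change v) + (# X * # X) * 1ℤ)
        ≡⟨ sum-lin₃ 1ℤ (+ 2) (# X * # X) (λ v → err X P v * err X P v) (λ v → err X P v * change v) (λ _ → 1ℤ) ⟩
      1ℤ * sum (λ v → err X P v * err X P v) + + 2 * sum (λ v → err X P v * change v) + (# X * # X) * # {n} full
        ≤⟨ ≤-from _ (0≤* (0≤+n {2}) (0≤∸ g≤0)) (lem (sum (λ v → err X P v * err X P v)) (sum (λ v → err X P v * change v)) (# X * # X) (# {n} full)) ⟩
      sum (λ v → err X P v * err X P v) + # {n} full * (# X * # X)
        ≡⟨ cong (λ z → sum (λ v → err X P v * err X P v) + z * (# X * # X)) (#-full {n}) ⟩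
      sum (λ v → err X P v * err X P v) + + n * (# X * # X) ∎
      where
      open ≤-Reasoning
      lem : ∀ s g m n → + 2 * (0ℤ - g) ≡ s + n * m - (1ℤ * s + + 2 * g + m * n)
      lem = solve-∀

  -- Adding up the changes at a fixed v over all x in X ∖ P cancels the error exactly: with m and t
  -- the sizes of X and P, m(deg X v - deg P v) - (m - t) deg X v = -err X P v.
  mean-change : ∀ {X P} → P ⊆ X →
    sum (λ x → χ (X ∖ P) x * sum (λ v → err X P v * (# X * A x v - deg X v))) ≡ sum (λ v → - (err X P v * err X P v))
  mean-change {X} {P} P⊆X = begin
    sum (λ x → χ R x * sum (λ v → err X P v * w x v))
      ≡⟨ sum-cong-≗ (λ x → *-distribˡ-sum (χ R x) (λ v → err X P v * w x v)) ⟩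
    sum (λ x → sum (λ v → χ R x * (err X P v * w x v)))
      ≡⟨ ∑-comm (λ x v → χ R x * (err X P v * w x v)) ⟩
    sum (λ v → sum (λ x → χ R x * (err X P v * w x v)))
      ≡⟨ sum-cong-≗ inner ⟩
    sum (λ v → - (err X P v * err X P v)) ∎
    where
    open ≡-Reasoning
    R = X ∖ P
    w : Fin n → Fin n → ℤ
    w x v = # X * A x v - deg X v
    lem₁ : ∀ r e m a δ → r * (e * (m * a - δ)) ≡ (e * m) * (r * a) + (- (e * δ)) * r
    lem₁ = solve-∀
    lem₂ : ∀ m p t δ → let e = m * p - t * δ in e * m * (δ - p) + - (e * δ) * (m - t) ≡ - (e * e)
    lem₂ = solve-∀
    inner : ∀ v → sum (λ x → χ R x * (err X P v * w x v)) ≡ - (err X P v * err X P v)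
    inner v = trans (sum-cong-≗ λ x → lem₁ (χ R x) (err X P v) (# X) (A x v) (deg X v))
      (trans (sum-lin₂ (err X P v * # X) (- (err X P v * deg X v)) (λ x → χ R x * A x v) (χ R))
      (trans (cong₂ (λ a b → err X P v * # X * a + - (err X P v * deg X v) * b) (deg-∖ P⊆X v) (#-∖ P⊆X))
      (lem₂ (# X) (deg P v) (# P) (deg X v))))

  greedy-step : ∀ {X P} → P ⊆ X → # P < # X →
    ∃ λ P′ → P′ ⊆ X × # P′ ≡ # P + 1ℤ ×
      sum (λ v → err X P′ v * err X P′ v) ≤ sum (λ v → err X P v * err X P v) + + n * (# X * # X)
  greedy-step {X} {P} P⊆X #P<#X = extend (∃-nonpos (X ∖ P) change-along 0<#R total≤0)
    where
    change-along : Fin n → ℤ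
    change-along x = sum (λ v → err X P v * (# X * A x v - deg X v))
    0<#R : 0ℤ < # (X ∖ P)
    0<#R = subst (0ℤ <_) (sym (#-∖ P⊆X)) (subst (_< # X - # P) (+-inverseʳ (# P)) (+-monoˡ-< (- # P) #P<#X))
    total≤0 : sum (λ x → χ (X ∖ P) x * change-along x) ≤ 0ℤ
    total≤0 = subst (_≤ 0ℤ) (sym (mean-change P⊆X)) (sum-≤0 {f = λ v → - (err X P v * err X P v)} λ v → neg-mono-≤ {0ℤ} (0≤sq (err X P v)))
    extend : (∃ λ x → (X ∖ P) x ≡ true × change-along x ≤ 0ℤ) → _
    extend (x , x∈R , g≤0) = P′ , P′⊆X , #P′ , bound g≤0
      where open Extend P⊆X x (proj₁ (∈-∖ {X} {P} x x∈R)) (proj₂ (∈-∖ {X} {P} x x∈R))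

∅ : ∀ {n} → Subset n
∅ _ = false

module Sampling {n : ℕ} (G : Graph n) where
  open Edges G public

  err-∅ : ∀ X v → err X ∅ v ≡ 0ℤ
  err-∅ X v = trans (cong₂ (λ a b → # X * a - b * deg X v) (sum-replicate-zero n) (sum-replicate-zero n)) (lem (# X) (deg X v))
    where
    lem : ∀ m δ → m * 0ℤ - 0ℤ * δ ≡ 0ℤ
    lem = solve-∀

  -- By mean-change some element of X ∖ P changes the error vector in a direction
  -- not positively correlated with it, so the squared norm grows only linearly.
  greedy : ∀ X t → + t ≤ # X → ∃ λ P → P ⊆ X × # P ≡ + t ×
    sum (λ v → err X P v * err X P v) ≤ + t * (+ n * (# X * # X))
  greedy X zero _ = ∅ , (λ _ ()) , sum-replicate-zero n ,
    sum-≤0 {f = λ v → err X ∅ v * err X ∅ v} (λ v → ≤-reflexive (cong (λ z → z * z) (err-∅ X v)))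
  greedy X (suc t) 1+t≤X = extend (greedy X t (<⇒≤ t<X))
    where
    t<X : + t < # X
    t<X = <-≤-trans (+<+ (ℕ.n<1+n t)) 1+t≤X
    extend : (∃ λ P → P ⊆ X × # P ≡ + t × sum (λ v → err X P v * err X P v) ≤ + t * (+ n * (# X * # X))) → _
    extend (P , P⊆X , #P , small) = step (greedy-step P⊆X (subst (_< # X) (sym #P) t<X))
      where
      step : (∃ λ P′ → P′ ⊆ X × # P′ ≡ # P + 1ℤ ×
        sum (λ v → err X P′ v * err X P′ v) ≤ sum (λ v → err X P v * err X P v) + + n * (# X * # X)) → _
      step (P′ , P′⊆X , #P′ , growth) = P′ , P′⊆X
        , trans #P′ (trans (cong (_+ 1ℤ) #P) (+-comm (+ t) 1ℤ))
        , ≤-trans growth (≤-trans (+-monoˡ-≤ (+ n * (# X * # X)) small) (≤-reflexive (lem (+ t) (+ n * (# X * # X)))))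
        where
        lem : ∀ t c → t * c + c ≡ (1ℤ + t) * c
        lem = solve-∀

  module Deviation (r : ℤ) where

    K : ℤ
    K = + n * r

    -- One P has to serve all W at once, because W may depend on P: `Sample-inner` takes W = P.
    -- Divided by the size of X, the bounds say that E P W is within K of its expectation.
    record Sample (X P : Subset n) : Set where
      field
        P⊆X   : P ⊆ X
        upper : ∀ W → # X * E P W ≤ # P * E X W + # X * K
        lower : ∀ W → # P * E X W ≤ # X * E P W + # X * K

    -- The deviations of P and X ∖ P sum to zero, so `upper` and `lower` trade places.
    complement : ∀ {X P} → Sample X P → Sample X (X ∖ P)
    complement {X} {P} s = record
      { P⊆X   = λ v Rv → proj₁ (∈-∖ {X} {P} v Rv)
      ; upper = λ W → ≤-from _ (0≤∸ (lower W)) (trans (lem₁ (# X) (# P) (E X W) (E P W) K)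
          (cong₂ (λ a b → a * E X W + # X * K - # X * b) (sym (#-∖ P⊆X)) (sym (E-∖ˡ P⊆X W))))
      ; lower = λ W → ≤-from _ (0≤∸ (upper W)) (trans (lem₂ (# X) (# P) (E X W) (E P W) K)
          (cong₂ (λ a b → # X * b + # X * K - a * E X W) (sym (#-∖ P⊆X)) (sym (E-∖ˡ P⊆X W))))
      }
      where
      open Sample s
      lem₁ : ∀ m t x p k → m * p + m * k - t * x ≡ (m - t) * x + m * k - m * (x - p)
      lem₁ = solve-∀
      lem₂ : ∀ m t x p k → t * x + m * k - m * p ≡ m * (x - p) + m * k - (m - t) * x
      lem₂ = solve-∀

    -- `upper` is applied for W = P and for W = X, leading from E P P through E X P to E X X. Since
    -- P is no larger than X, the two errors together are at most 2K.
    Sample-inner : 0ℤ ≤ K → ∀ {X P} → Sample X P →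
      # X * # X * E P P ≤ # P * # P * E X X + + 2 * (# X * # X * K)
    Sample-inner 0≤K {X} {P} s = ≤-from _
      (0≤+ (0≤+ (0≤* (0≤# X) (0≤∸ (upper P))) (0≤* (0≤# P) (0≤∸ (subst (λ z → # X * z ≤ # P * E X X + # X * K) (E-sym P X) (upper X)))))
           (0≤* (0≤* (0≤# X) 0≤K) (0≤∸ (#-mono P⊆X))))
      (lem (# X) (# P) (E P P) (E X P) (E X X) K)
      where
      open Sample s
      lem : ∀ m t p y x k → m * (t * y + m * k - m * p) + t * (t * x + m * k - m * y) + m * k * (m - t)
        ≡ t * t * x + + 2 * (m * m * k) - m * m * p
      lem = solve-∀

    module _ (0<r : 0ℤ < r) (n≤r² : + n ≤ r * r) where

      0≤K : 0ℤ ≤ K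
      0≤K = 0≤* (0≤+n {n}) (<⇒≤ 0<r)

      private
        pointwise : ∀ j e b → + 2 * j * (e * ι b) ≤ 1ℤ * (e * e) + j * j * 1ℤ
        pointwise j e true  = ≤-from _ (0≤sq (e - j)) (lem j e)
          where
          lem : ∀ j e → (e - j) * (e - j) ≡ 1ℤ * (e * e) + j * j * 1ℤ - + 2 * j * (e * 1ℤ)
          lem = solve-∀
        pointwise j e false = ≤-from _ (0≤+ (0≤sq e) (0≤sq j)) (lem j e)
          where
          lem : ∀ j e → e * e + j * j ≡ 1ℤ * (e * e) + j * j * 1ℤ - + 2 * j * (e * 0ℤ)
          lem = solve-∀

        err-sum : ∀ X P W → sum (λ v → err X P v * χ W v) ≡ # X * E P W + - # P * E X W
        err-sum X P W = trans (sum-cong-≗ λ v → lem (# X) (deg P v) (# P) (deg X v) (χ W v))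
          (sum-lin₂ (# X) (- # P) (λ v → deg P v * χ W v) (λ v → deg X v * χ W v))
          where
          lem : ∀ m p t x w → (m * p - t * x) * w ≡ m * (p * w) + - t * (x * w)
          lem = solve-∀

        total : ∀ X P W j → + 2 * j * (# X * E P W + - # P * E X W) ≤
          1ℤ * sum (λ v → err X P v * err X P v) + j * j * + n
        total X P W j = begin
          + 2 * j * (# X * E P W + - # P * E X W)                ≡⟨ cong (_*_ (+ 2 * j)) (err-sum X P W) ⟨
          + 2 * j * sum (λ v → err X P v * χ W v)                ≡⟨ *-distribˡ-sum (+ 2 * j) (λ v → err X P v * χ W v) ⟩
          sum (λ v → + 2 * j * (err X P v * χ W v))              ≤⟨ sum-mono (λ v → pointwise j (err X P v) (W v)) ⟩
          sum (λ v → 1ℤ * (err X P v * err X P v) + j * j * 1ℤ)  ≡⟨ sum-lin₂ 1ℤ (j * j) (λ v → err X P v * err X P v) (λ _ → 1ℤ) ⟩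
          1ℤ * sum (λ v → err X P v * err X P v) + j * j * # {n} full ≡⟨ cong (λ z → 1ℤ * sum (λ v → err X P v * err X P v) + j * j * z) (#-full {n}) ⟩
          1ℤ * sum (λ v → err X P v * err X P v) + j * j * + n ∎
          where open ≤-Reasoning

      -- Cauchy-Schwarz over W in the form 2je ≤ e² + j², which needs no roots. With m the size of
      -- X, take j = mr for `upper` and j = -mr for `lower`: the squared norm is at most m²n·n ≤
      -- m²nr², the terms j² add up to m²nr², and dividing by 2mr leaves mnr = mK.
      small⇒Sample : ∀ {X P} → 0ℤ < # X → P ⊆ X →
        sum (λ v → err X P v * err X P v) ≤ # P * (+ n * (# X * # X)) → Sample X P
      small⇒Sample {X} {P} 0<X P⊆X small = record
        { P⊆X   = P⊆X
        ; upper = λ W → *-cancelˡ-≤ (+ 2 * (# X * r)) 0<2mr (≤-from _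
            (0≤+ (0≤∸ (total X P W (# X * r))) slack)
            (lem (# X) (# P) r (+ n) (E P W) (E X W) (sum (λ v → err X P v * err X P v))))
        ; lower = λ W → *-cancelˡ-≤ (+ 2 * (# X * r)) 0<2mr (≤-from _
            (0≤+ (0≤∸ (total X P W (- (# X * r)))) slack)
            (lem′ (# X) (# P) r (+ n) (E P W) (E X W) (sum (λ v → err X P v * err X P v))))
        }
        where
        0<2mr = 0<* (0<+ {1}) (0<* 0<X 0<r)
        slack = 0≤+ (0≤∸ small) (0≤* (0≤* (0≤+n {n}) (0≤sq (# X)))
          (0≤+ (0≤∸ (#-mono P⊆X)) (0≤+ (0≤∸ (#≤n X)) (0≤∸ n≤r²))))
        lem : ∀ m t r n p x s →
          1ℤ * s + (m * r) * (m * r) * n - + 2 * (m * r) * (m * p + - t * x) +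
          (t * (n * (m * m)) - s + n * (m * m) * (m - t + (n - m + (r * r - n))))
          ≡ + 2 * (m * r) * (t * x + m * (n * r)) - + 2 * (m * r) * (m * p)
        lem = solve-∀
        lem′ : ∀ m t r n p x s →
          1ℤ * s + (- (m * r)) * (- (m * r)) * n - + 2 * (- (m * r)) * (m * p + - t * x) +
          (t * (n * (m * m)) - s + n * (m * m) * (m - t + (n - m + (r * r - n))))
          ≡ + 2 * (m * r) * (m * p + m * (n * r)) - + 2 * (m * r) * (t * x)
        lem′ = solve-∀

      sample : ∀ X t → 0ℤ < # X → + t ≤ # X → ∃ λ P → # P ≡ + t × Sample X P
      sample X t 0<X t≤X = convert (greedy X t t≤X)
        where
        convert : (∃ λ P → P ⊆ X × # P ≡ + t × sum (λ v → err X P v * err X P v) ≤ + t * (+ n * (# X * # X))) → _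
        convert (P , P⊆X , #P , small) = P , #P ,
          small⇒Sample 0<X P⊆X (subst (λ z → sum (λ v → err X P v * err X P v) ≤ z * (+ n * (# X * # X))) (sym #P) small)

-- Triangle-free graphs

⊆-full : ∀ {n} {S : Subset n} → S ⊆ full
⊆-full _ _ = refl

module TriangleFreeGraph {n : ℕ} (G : Graph n) (tf : TriangleFree G) where
  open Sampling G public

  N : Fin n → Subset n
  N v u = adj G v u

  d D : Fin n → ℤ
  d v = deg full v
  D v = E full (N v)

  M : ℤ
  M = E full full

  #N : ∀ v → # (N v) ≡ d v
  #N v = sum-cong-≗ λ u → trans (A-sym v u) (sym (*-identityˡ (A u v)))

  sum-d : sum d ≡ M
  sum-d = sum-cong-≗ λ v → sym (*-identityʳ (d v))

  sum-D : sum D ≡ sum (λ v → d v * d v)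
  sum-D = trans (∑-comm (λ v u → d u * A v u)) (sum-cong-≗ λ u →
    trans (sym (*-distribˡ-sum (d u) (λ v → A v u)))
          (cong (_*_ (d u)) (sum-cong-≗ λ v → sym (*-identityˡ (A v u)))))

  -- Adjacent vertices have no common neighbour.
  deg-adjacent : ∀ W t t′ → adj G t t′ ≡ true → deg W t + deg W t′ ≤ # W
  deg-adjacent W t t′ tt′ = subst (_≤ # W) (∑-distrib-+ (λ u → χ W u * A u t) (λ u → χ W u * A u t′)) (sum-mono bound)
    where
    bound : ∀ u → χ W u * A u t + χ W u * A u t′ ≤ χ W u
    bound u with W u | adj G u t in ut | adj G u t′ in ut′
    ... | false | _     | _     = ≤-refl
    ... | true  | true  | true  = ⊥-elim (tf u t t′ ut tt′ ut′)
    ... | true  | true  | false = ≤-refl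
    ... | true  | false | true  = ≤-refl
    ... | true  | false | false = +≤+ z≤n

  -- Sums deg-adjacent over the edges tt′ inside J.
  weighted-degrees : ∀ J W →
    + 2 * sum (λ t → χ J t * (deg J t * deg W t)) ≤ # W * E J J
  weighted-degrees J W = begin
    + 2 * T                      ≡⟨ lem T ⟩
    T + T                        ≡⟨ cong₂ _+_ by-columns by-rows ⟩
    sum (λ t → sum (λ u → f u t * deg W t)) + sum (λ t → sum (λ u → f u t * deg W u))
      ≡⟨ ∑-distrib-+ (λ t → sum (λ u → f u t * deg W t)) (λ t → sum (λ u → f u t * deg W u)) ⟨
    sum (λ t → sum (λ u → f u t * deg W t) + sum (λ u → f u t * deg W u))
      ≡⟨ sum-cong-≗ (λ t → ∑-distrib-+ (λ u → f u t * deg W t) (λ u → f u t * deg W u)) ⟨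
    sum (λ t → sum (λ u → f u t * deg W t + f u t * deg W u))
      ≤⟨ sum-mono (λ t → sum-mono (bound t)) ⟩
    sum (λ t → sum (λ u → # W * f u t))
      ≡⟨ sum-cong-≗ (λ t → *-distribˡ-sum (# W) (λ u → f u t)) ⟨
    sum (λ t → # W * sum (λ u → f u t))
      ≡⟨ *-distribˡ-sum (# W) (λ t → sum (λ u → f u t)) ⟨
    # W * sum (λ t → sum (λ u → f u t))
      ≡⟨ cong (_*_ (# W)) (sum-cong-≗ λ t → sym (collect t)) ⟩
    # W * E J J                  ∎
    where
    open ≤-Reasoning
    f : Fin n → Fin n → ℤ
    f u t = χ J t * (χ J u * A u t)
    T = sum (λ t → χ J t * (deg J t * deg W t))
    lem : ∀ x → + 2 * x ≡ x + x
    lem = solve-∀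
    collect : ∀ t → deg J t * χ J t ≡ sum (λ u → f u t)
    collect t = trans (*-comm (deg J t) (χ J t)) (*-distribˡ-sum (χ J t) (λ u → χ J u * A u t))
    by-columns : T ≡ sum (λ t → sum (λ u → f u t * deg W t))
    by-columns = sum-cong-≗ λ t → trans (lem₁ (χ J t) (deg J t) (deg W t))
      (trans (cong (_*_ (deg W t)) (collect t)) (trans (*-distribˡ-sum (deg W t) (λ u → f u t))
        (sum-cong-≗ λ u → *-comm (deg W t) (f u t))))
      where
      lem₁ : ∀ c y z → c * (y * z) ≡ z * (y * c)
      lem₁ = solve-∀
    f-sym : ∀ u t → f u t ≡ f t u
    f-sym u t = trans (cong (λ a → χ J t * (χ J u * a)) (A-sym u t)) (lem₂ (χ J t) (χ J u) (A t u))
      where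
      lem₂ : ∀ x y a → x * (y * a) ≡ y * (x * a)
      lem₂ = solve-∀
    by-rows : T ≡ sum (λ t → sum (λ u → f u t * deg W u))
    by-rows = trans by-columns (trans (∑-comm (λ t u → f u t * deg W t))
      (sum-cong-≗ λ t → sum-cong-≗ λ u → cong (_* deg W u) (f-sym t u)))
    bound : ∀ t u → f u t * deg W t + f u t * deg W u ≤ # W * f u t
    bound t u with J t | J u | adj G u t in ut
    ... | true  | true  | true  = subst₂ _≤_ (lem₃ (deg W t) (deg W u)) (sym (*-identityʳ (# W))) (deg-adjacent W u t ut)
      where
      lem₃ : ∀ x y → y + x ≡ 1ℤ * x + 1ℤ * y
      lem₃ = solve-∀
    ... | true  | true  | false = ≤-reflexive (sym (*-zeroʳ (# W)))
    ... | true  | false | _     = ≤-reflexive (sym (*-zeroʳ (# W)))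
    ... | false | _     | _     = ≤-reflexive (sym (*-zeroʳ (# W)))

  N-independent : ∀ v → E (N v) (N v) ≡ 0ℤ
  N-independent v = trans (sum-cong-≗ zero-term) (sum-replicate-zero n)
    where
    zero-term : ∀ w → deg (N v) w * A v w ≡ 0ℤ
    zero-term w with adj G v w in vw
    ... | false = *-zeroʳ (deg (N v) w)
    ... | true  = trans (*-identityʳ (deg (N v) w)) (trans (sum-cong-≗ no-common) (sum-replicate-zero n))
      where
      no-common : ∀ u → A v u * A u w ≡ 0ℤ
      no-common u with adj G v u in vu | adj G u w in uw
      ... | true  | true  = ⊥-elim (tf v u w vu uw vw)
      ... | true  | false = refl
      ... | false | _     = refl

  -- Expanding Σ(2d - n)² ≥ 0 gives 4nM - n³ ≤ 4Σd², and `weighted-degrees` with J = W = V gives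
  -- 4Σd² ≤ 2nM.
  mantel : 0ℤ < + n → + 2 * M ≤ + n * + n
  mantel 0<n = *-cancelˡ-≤ (+ n) 0<n (≤-from _
    (0≤+ (sum-0≤ {f = λ v → (+ 2 * d v - + n) * (+ 2 * d v - + n)} (λ v → 0≤sq (+ 2 * d v - + n)))
         (0≤* (0≤+n {2}) (0≤∸ (weighted-degrees full full))))
    (trans (cong₂ (λ a b → a + + 2 * (b * M - + 2 * S)) expand (#-full {n})) (lem (+ n) M S)))
    where
    S = sum (λ v → 1ℤ * (d v * d v))
    lem₁ : ∀ n d → (+ 2 * d - n) * (+ 2 * d - n) ≡ + 4 * (1ℤ * (d * d)) + (- (+ 4 * n)) * (d * 1ℤ) + n * n * 1ℤ
    lem₁ = solve-∀
    expand : sum (λ v → (+ 2 * d v - + n) * (+ 2 * d v - + n)) ≡ + 4 * S + (- (+ 4 * + n)) * M + + n * + n * + n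
    expand = trans (sum-cong-≗ λ v → lem₁ (+ n) (d v))
      (trans (sum-lin₃ (+ 4) (- (+ 4 * + n)) (+ n * + n) (λ v → 1ℤ * (d v * d v)) (λ v → d v * 1ℤ) (λ _ → 1ℤ))
        (cong (λ z → + 4 * S + (- (+ 4 * + n)) * M + + n * + n * z) (#-full {n})))
    lem : ∀ n M S → + 4 * S + (- (+ 4 * n)) * M + n * n * n + + 2 * (n * M - + 2 * S) ≡ n * (n * n) - n * (+ 2 * M)
    lem = solve-∀

  module Around (v : Fin n) where

    I J : Subset n
    I = N v
    J = full ∖ I

    #J : # J ≡ + n - d v
    #J = trans (#-∖ {P = I} {full} ⊆-full) (cong₂ _-_ (#-full {n}) (#N v))

    E-IJ : E J I ≡ D v
    E-IJ = trans (E-∖ˡ {I} {full} ⊆-full I) (trans (cong (λ z → D v - z) (N-independent v)) (lem (D v)))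
      where
      lem : ∀ x → x - 0ℤ ≡ x
      lem = solve-∀

    E-JJ : E J J ≡ M - + 2 * D v
    E-JJ = trans (E-∖ˡ {I} {full} ⊆-full J) (trans (cong₂ _-_
        (trans (E-sym full J) (trans (E-∖ˡ {I} {full} ⊆-full full) (cong (λ z → M - z) (E-sym I full))))
        (trans (E-sym I J) E-IJ)) (lem M (D v)))
      where
      lem : ∀ m x → m - x - x ≡ m - + 2 * x
      lem = solve-∀

  exists-good : 0ℤ < + n → ∃ λ v → gap (+ n) (+ n * + n - + 2 * M) (d v) (D v) ≤ 0ℤ
  exists-good 0<n = forget (∃-nonpos full g (subst (0ℤ <_) (sym (#-full {n})) 0<n) (≤-reflexive total))
    where
    U = + n * + n - + 2 * M
    c = + 8 * + n * + n + + 15 * U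
    g : Fin n → ℤ
    g v = gap (+ n) U (d v) (D v)
    forget : (∃ λ v → full v ≡ true × g v ≤ 0ℤ) → ∃ λ v → g v ≤ 0ℤ
    forget (v , _ , gv) = v , gv
    lem₁ : ∀ n U d D → 1ℤ * (+ 32 * n * n * (d * d - D) - (+ 8 * n * n + + 15 * U) * (+ 2 * n * d - n * n + U)) ≡
      (+ 32 * n * n * (d * d) + (- (+ 32 * n * n)) * D) +
      ((- ((+ 8 * n * n + + 15 * U) * (+ 2 * n))) * d + ((+ 8 * n * n + + 15 * U) * (n * n - U)) * 1ℤ)
    lem₁ = solve-∀
    lem₂ : ∀ n M S → let U = n * n - + 2 * M; c = + 8 * n * n + + 15 * U in
      (+ 32 * n * n * S + (- (+ 32 * n * n)) * S) + ((- (c * (+ 2 * n))) * M + (c * (n * n - U)) * n) ≡ 0ℤ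
    lem₂ = solve-∀
    S = sum (λ v → d v * d v)
    total : sum (λ v → 1ℤ * g v) ≡ 0ℤ
    total = trans (sum-cong-≗ λ v → lem₁ (+ n) U (d v) (D v))
      (trans (∑-distrib-+ (λ v → + 32 * + n * + n * (d v * d v) + (- (+ 32 * + n * + n)) * D v) (λ v → (- (c * (+ 2 * + n))) * d v + (c * (+ n * + n - U)) * 1ℤ))
      (trans (cong₂ _+_ (sum-lin₂ (+ 32 * + n * + n) (- (+ 32 * + n * + n)) (λ v → d v * d v) D)
                        (sum-lin₂ (- (c * (+ 2 * + n))) (c * (+ n * + n - U)) d (λ _ → 1ℤ)))
      (trans (cong₂ _+_ (cong (λ z → + 32 * + n * + n * S + (- (+ 32 * + n * + n)) * z) sum-D)
                        (cong₂ (λ a b → (- (c * (+ 2 * + n))) * a + (c * (+ n * + n - U)) * b) sum-d (#-full {n})))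
      (lem₂ (+ n) M S))))

-- The set S

module Balancing {n : ℕ} (G : Graph n) (tf : TriangleFree G)
  (h : ℕ) (n≡3h : + n ≡ + 3 * + h) (0<n : 0ℤ < + n)
  (r : ℤ) (0<r : 0ℤ < r) (n≤r² : + n ≤ r * r) where

  open TriangleFreeGraph G tf public
  open Deviation r public

  private
    0≤K′ = 0≤K 0<r n≤r²

  -- As E counts twice: e(S) ≤ n²/48 + 2K and e(V ∖ S) ≤ n²/12 + K.
  Balanced : Subset n → Set
  Balanced S = # S ≡ + h
    × + 24 * E S S ≤ + n * + n + + 96 * K
    × + 6 * E (full ∖ S) (full ∖ S) ≤ + n * + n + + 12 * K

  E-cong : ∀ {S S′ : Subset n} → (∀ v → S v ≡ S′ v) → E S S ≡ E S′ S′
  E-cong {S} {S′} eq = sum-cong-≗ λ v → cong₂ _*_ (sum-cong-≗ λ u → cong (λ b → ι b * A u v) (eq u)) (cong ι (eq v))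

  E-mono-inner : ∀ {P X} → P ⊆ X → E P P ≤ E X X
  E-mono-inner {P} {X} P⊆X = ≤-trans (E-monoʳ P P⊆X) (≤-trans (≤-reflexive (E-sym P X)) (E-monoʳ X P⊆X))

  E-inner-∪ : ∀ {P X : Subset n} → (∀ v → X v ≡ true → P v ≡ false) → E (X ∪ P) (X ∪ P) ≡ E X X + + 2 * E P X + E P P
  E-inner-∪ {P} {X} disj = trans (E-∪ˡ disj (X ∪ P)) (trans
    (cong₂ _+_ (trans (E-sym X (X ∪ P)) (E-∪ˡ disj X)) (trans (E-sym P (X ∪ P)) (trans (E-∪ˡ disj P) (cong (_+ E P P) (E-sym X P)))))
    (lem (E X X) (E P X) (E P P)))
    where
    lem : ∀ x y z → x + y + (y + z) ≡ x + + 2 * y + z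
    lem = solve-∀

  -- Both requirements scale to the same condition: a third of V carries M/9 and the other two
  -- thirds 4M/9, and 24 · M/9 = 6 · 4M/9 ≤ n² means 8M ≤ 3n².
  sparse : + 8 * M ≤ + 3 * (+ n * + n) → ∃ Balanced
  sparse 8M≤3n² = build (sample 0<r n≤r² full h (subst (0ℤ <_) (sym #f) 0<n) (subst (+ h ≤_) (sym #f) h≤n))
    where
    #f = #-full {n}
    h≤n : + h ≤ + n
    h≤n = ≤-from _ (0≤+ (0≤* (0≤+n {2}) (0≤+n {h})) (0≤-zero 1ℤ n≡3h)) (lem (+ n) (+ h))
      where
      lem : ∀ n h → + 2 * h + 1ℤ * (n - + 3 * h) ≡ n - h
      lem = solve-∀
    cert₁ : ∀ n h M P K →
      + 72 * (h * h * M + + 2 * (n * n * K) - n * n * P) + n * n * (+ 3 * (n * n) - + 8 * M) + + 144 * (n * n) * K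
        + (+ 8 * M * (n + + 3 * h)) * (n - + 3 * h)
      ≡ + 3 * (n * n) * (n * n + + 96 * K) - + 3 * (n * n) * (+ 24 * P)
    cert₁ = solve-∀
    cert₂ : ∀ n h M Q K →
      + 18 * ((n - h) * (n - h) * M + + 2 * (n * n * K) - n * n * Q) + n * n * (+ 3 * (n * n) - + 8 * M)
        + (- (M * (+ 10 * n - + 6 * h))) * (n - + 3 * h)
      ≡ + 3 * (n * n) * (n * n + + 12 * K) - + 3 * (n * n) * (+ 6 * Q)
    cert₂ = solve-∀
    0<3n² = 0<* (0<+ {2}) (0<* 0<n 0<n)
    build : (∃ λ P → # P ≡ + h × Sample full P) → ∃ Balanced
    build (P , #P , s) = P , #P
      , *-cancelˡ-≤ (+ 3 * (+ n * + n)) 0<3n² (≤-from _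
          (0≤+ (0≤+ (0≤+ (0≤* (0≤+n {72}) (0≤∸ fact₁)) (0≤* (0≤sq (+ n)) (0≤∸ 8M≤3n²)))
            (0≤* (0≤* (0≤+n {144}) (0≤sq (+ n))) 0≤K′)) (0≤-zero (+ 8 * M * (+ n + + 3 * + h)) n≡3h))
          (cert₁ (+ n) (+ h) M (E P P) K))
      , *-cancelˡ-≤ (+ 3 * (+ n * + n)) 0<3n² (≤-from _
          (0≤+ (0≤+ (0≤* (0≤+n {18}) (0≤∸ fact₂)) (0≤* (0≤sq (+ n)) (0≤∸ 8M≤3n²)))
            (0≤-zero (- (M * (+ 10 * + n - + 6 * + h))) n≡3h))
          (cert₂ (+ n) (+ h) M (E (full ∖ P) (full ∖ P)) K))
      where
      fact₁ : + n * + n * E P P ≤ + h * + h * M + + 2 * (+ n * + n * K)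
      fact₁ = subst₂ (λ m t → m * m * E P P ≤ t * t * M + + 2 * (m * m * K)) #f #P (Sample-inner 0≤K′ s)
      fact₂ : + n * + n * E (full ∖ P) (full ∖ P) ≤ (+ n - + h) * (+ n - + h) * M + + 2 * (+ n * + n * K)
      fact₂ = subst₂ (λ m t → m * m * E (full ∖ P) (full ∖ P) ≤ t * t * M + + 2 * (m * m * K)) #f
        (trans (#-∖ {P = P} {full} ⊆-full) (cong₂ _-_ #f #P)) (Sample-inner 0≤K′ (complement s))

  private
    0<third : ∀ {x} → + n ≤ + 3 * x → 0ℤ < x
    0<third {x} n≤3x = *-cancelˡ-<-nonNeg (+ 3) (<-≤-trans 0<n n≤3x)

    h≤third : ∀ {x} → + n ≤ + 3 * x → + h ≤ x
    h≤third {x} n≤3x = *-cancelˡ-≤ (+ 3) (0<+ {2}) (subst (_≤ + 3 * x) n≡3h n≤3x)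

  module At (v : Fin n) where
    open Around v

    private
      a = d v
      b = + n - d v
      Y = M - + 2 * D v

    -- A sample P of the independent set N(v) spans no edge, so E on V ∖ P is M - 2 E P V. By
    -- `lower`, E P V is at least (h/a) D - K, and with h = n/3 `good` makes this large enough.
    inside-N : + n ≤ + 3 * a → a * (+ 6 * M - + n * + n) ≤ + 4 * + n * D v → ∃ Balanced
    inside-N n≤3a good = build (sample 0<r n≤r² I h (subst (0ℤ <_) (sym (#N v)) (0<third n≤3a)) (subst (+ h ≤_) (sym (#N v)) (h≤third n≤3a)))
      where
      cert : ∀ n h a D M q K →
        + 12 * (a * q + a * K - h * D) + (+ 4 * n * D - a * (+ 6 * M - n * n)) + (- (+ 4 * D)) * (n - + 3 * h)
        ≡ a * (n * n + + 12 * K) - a * (+ 6 * (M - + 2 * q))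
      cert = solve-∀
      build : (∃ λ P → # P ≡ + h × Sample I P) → ∃ Balanced
      build (P , #P , s) = P , #P
        , subst (λ z → + 24 * z ≤ + n * + n + + 96 * K) (sym EPP) (0≤+ (0≤sq (+ n)) (0≤* (0≤+n {96}) 0≤K′))
        , *-cancelˡ-≤ a (0<third n≤3a) (subst (λ z → a * (+ 6 * z) ≤ a * (+ n * + n + + 12 * K)) (sym ES̄S̄)
            (≤-from _ (0≤+ (0≤+ (0≤* (0≤+n {12}) (0≤∸ fact)) (0≤∸ good)) (0≤-zero (- (+ 4 * D v)) n≡3h))
              (cert (+ n) (+ h) a (D v) M (E P full) K)))
        where
        open Sample s
        EPP : E P P ≡ 0ℤ
        EPP = ≤-antisym (subst (E P P ≤_) (N-independent v) (E-mono-inner P⊆X)) (0≤E P P)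
        fact : + h * D v ≤ a * E P full + a * K
        fact = subst₂ (λ m x → + h * x ≤ m * E P full + m * K) (#N v) (E-sym I full)
          (subst (λ t → t * E I full ≤ # I * E P full + # I * K) #P (lower full))
        ES̄S̄ : E (full ∖ P) (full ∖ P) ≡ M - + 2 * E P full
        ES̄S̄ = trans (E-∖ˡ {P} {full} ⊆-full (full ∖ P)) (trans (cong₂ _-_
          (trans (E-sym full (full ∖ P)) (E-∖ˡ {P} {full} ⊆-full full))
          (trans (E-sym P (full ∖ P)) (trans (E-∖ˡ {P} {full} ⊆-full P) (cong₂ _-_ (E-sym full P) EPP))))
          (lem M (E P full)))
          where
          lem : ∀ m q → m - q - (q - 0ℤ) ≡ m - + 2 * q
          lem = solve-∀

    -- `good` bounds the density of J as in `gap-middle`. The last hypothesis is 24(2(t/b)D +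
    -- (t/b)²(M - 2D)) ≤ n², the expected count inside N(v) ∪ T, multiplied by 3b². Here 3t = θ, and
    -- 3b - θ = 2n merges the two terms in D.
    around-N : 0ℤ < b → 0ℤ ≤ + h - a →
      + 8 * M - + 3 * (b * b) ≤ + 16 * D v →
      + 8 * ((+ n - + 3 * a) * (+ n - + 3 * a)) * M + + 32 * + n * (+ n - + 3 * a) * D v ≤ + 3 * (+ n * + n) * (b * b) →
      ∃ Balanced
    around-N 0<b 0≤t good low = build (sample 0<r n≤r² J ∣ + h - a ∣ (subst (0ℤ <_) (sym #J) 0<b)
        (subst₂ _≤_ (sym t≡) (sym #J) t≤b))
      where
      t = + h - a
      θ = + n - + 3 * a
      t≡ : + ∣ t ∣ ≡ t
      t≡ = 0≤i⇒+∣i∣≡i 0≤t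
      t≤b : t ≤ b
      t≤b = ≤-from _ (0≤+ (0≤* (0≤+n {2}) (0≤+n {h})) (0≤-zero 1ℤ n≡3h)) (lem (+ n) (+ h) a)
        where
        lem : ∀ n h a → + 2 * h + 1ℤ * (n - + 3 * h) ≡ n - a - (h - a)
        lem = solve-∀
      -- The errors of `fact₁` and `fact₂` amount to 144b²K each, together 3b² · 96K: this case
      -- determines the 96K in `Balanced`.
      cert₁ : ∀ n h a D M TT TI K → let b = n - a; t = h - a; Y = M - + 2 * D; θ = n - + 3 * a in
        + 72 * (t * t * Y + + 2 * (b * b * K) - b * b * TT) + + 144 * b * (t * D + b * K - b * TI)
          + (+ 3 * (n * n) * (b * b) - (+ 8 * (θ * θ) * M + + 32 * n * θ * D))
          + (+ 16 * θ * Y - + 8 * (n - + 3 * h) * Y + + 48 * b * D) * (n - + 3 * h)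
        ≡ + 3 * (b * b) * (n * n + + 96 * K) - + 3 * (b * b) * (+ 24 * (0ℤ + + 2 * TI + TT))
      cert₁ = solve-∀
      cert₂ : ∀ n h a D M Z K → let b = n - a; t = h - a; Y = M - + 2 * D in
        + 18 * ((b - t) * (b - t) * Y + + 2 * (b * b * K) - b * b * Z)
          + n * n * (+ 16 * D - (+ 8 * M - + 3 * (b * b)))
          + (- ((+ 10 * n - + 6 * h) * Y)) * (n - + 3 * h)
        ≡ + 3 * (b * b) * (n * n + + 12 * K) - + 3 * (b * b) * (+ 6 * Z)
      cert₂ = solve-∀
      0<3b² = 0<* (0<+ {2}) (0<* 0<b 0<b)
      build : (∃ λ T → # T ≡ + ∣ t ∣ × Sample J T) → ∃ Balanced
      build (T , #T′ , s) = I ∪ T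
        , trans (#-∪ disj) (trans (cong₂ _+_ (#N v) #T) (lem a (+ h)))
        , *-cancelˡ-≤ (+ 3 * (b * b)) 0<3b² (subst (λ z → + 3 * (b * b) * (+ 24 * z) ≤ + 3 * (b * b) * (+ n * + n + + 96 * K)) (sym ESS)
            (≤-from _ (0≤+ (0≤+ (0≤+ (0≤* (0≤+n {72}) (0≤∸ fact₁)) (0≤* (0≤* (0≤+n {144}) (<⇒≤ 0<b)) (0≤∸ fact₂))) (0≤∸ low))
                (0≤-zero (+ 16 * θ * Y - + 8 * (+ n - + 3 * + h) * Y + + 48 * b * D v) n≡3h))
              (cert₁ (+ n) (+ h) a (D v) M (E T T) (E T I) K)))
        , *-cancelˡ-≤ (+ 3 * (b * b)) 0<3b² (subst (λ z → + 3 * (b * b) * (+ 6 * z) ≤ + 3 * (b * b) * (+ n * + n + + 12 * K)) (E-cong same)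
            (≤-from _ (0≤+ (0≤+ (0≤* (0≤+n {18}) (0≤∸ fact₃)) (0≤* (0≤sq (+ n)) (0≤∸ good)))
                (0≤-zero (- ((+ 10 * + n - + 6 * + h) * Y)) n≡3h))
              (cert₂ (+ n) (+ h) a (D v) M (E (J ∖ T) (J ∖ T)) K)))
        where
        open Sample s
        #T : # T ≡ t
        #T = trans #T′ t≡
        lem : ∀ a h → a + (h - a) ≡ h
        lem = solve-∀
        disj : ∀ u → I u ≡ true → T u ≡ false
        disj u Iu with T u in Tu
        ... | false = refl
        ... | true  = contradiction (trans (sym (proj₂ (∈-∖ {full} {I} u (P⊆X u Tu)))) Iu) λ ()
        same : ∀ u → (J ∖ T) u ≡ (full ∖ (I ∪ T)) u
        same u with I u | T u
        ... | true  | _     = refl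
        ... | false | true  = refl
        ... | false | false = refl
        ESS : E (I ∪ T) (I ∪ T) ≡ 0ℤ + + 2 * E T I + E T T
        ESS = trans (E-inner-∪ disj) (cong (λ z → z + + 2 * E T I + E T T) (N-independent v))
        fact₁ : b * b * E T T ≤ t * t * Y + + 2 * (b * b * K)
        fact₁ = subst (λ y → b * b * E T T ≤ t * t * y + + 2 * (b * b * K)) E-JJ
          (subst₂ (λ m t → m * m * E T T ≤ t * t * E J J + + 2 * (m * m * K)) #J #T (Sample-inner 0≤K′ s))
        fact₂ : b * E T I ≤ t * D v + b * K
        fact₂ = subst (λ y → b * E T I ≤ t * y + b * K) E-IJ
          (subst₂ (λ m t → m * E T I ≤ t * E J I + m * K) #J #T (upper I))
        fact₃ : b * b * E (J ∖ T) (J ∖ T) ≤ (b - t) * (b - t) * Y + + 2 * (b * b * K)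
        fact₃ = subst (λ y → b * b * E (J ∖ T) (J ∖ T) ≤ (b - t) * (b - t) * y + + 2 * (b * b * K)) E-JJ
          (subst₂ (λ m t → m * m * E (J ∖ T) (J ∖ T) ≤ t * t * E J J + + 2 * (m * m * K)) #J
            (trans (#-∖ P⊆X) (cong₂ _-_ #J #T)) (Sample-inner 0≤K′ (complement s)))

    -- J contains v, as v is not its own neighbour.
    0<b : 0ℤ < b
    0<b = subst (0ℤ <_) #J (<-≤-trans (+<+ (s≤s z≤n)) (subst (_≤ # J) (#-singleton v) (#-mono singleton⊆J)))
      where
      singleton⊆J : singleton v ⊆ J
      singleton⊆J u eq with u ≟ v
      ... | yes refl = cong not (adj-irrefl G u)

    -- Sums 4(1 − ζ)β² + 4ζ(β − α)² ≥ 0 over the vertices of J, with ζ = deg I / a,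
    -- α = n/2 − b and β = n/4 − deg J; the quadratic terms are controlled by
    -- weighted-degrees.
    moment-bound : + 2 * b ≤ + n → + 8 * a * Y + + 8 * (+ n - + 2 * b) * D v ≤ a * (+ n * + n)
    moment-bound 2b≤n = *-cancelˡ-≤ b 0<b (≤-from _
      (0≤+ (0≤+ moments (0≤* (0≤* (0≤+n {8}) 0≤a) (0≤∸ square-bound)))
           (0≤* (0≤* (0≤+n {8}) (0≤∸ 2b≤n)) (0≤∸ product-bound)))
      (cert (+ n) a b Y (D v) S₂ Q))
      where
      y z : Fin n → ℤ
      y t = deg J t
      z t = deg I t
      S₂ = sum (λ t → χ J t * (y t * y t))
      Q  = sum (λ t → χ J t * (y t * z t))
      0≤a : 0ℤ ≤ a
      0≤a = 0≤deg full v
      square-bound : + 2 * S₂ ≤ b * Y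
      square-bound = subst₂ (λ m x → + 2 * S₂ ≤ m * x) #J E-JJ (weighted-degrees J J)
      product-bound : + 2 * Q ≤ a * Y
      product-bound = subst₂ (λ m x → + 2 * Q ≤ m * x) (#N v) E-JJ (weighted-degrees J I)
      -- The summand scaled by 4a, which clears the denominators of ζ and β.
      term : Fin n → ℤ
      term t = χ J t * ((a - z t) * ((+ n - + 4 * y t) * (+ n - + 4 * y t))
                          + z t * ((+ 4 * b - + 4 * y t - + n) * (+ 4 * b - + 4 * y t - + n)))
      0≤term : ∀ t → 0ℤ ≤ term t
      0≤term t = 0≤* (0≤ι (J t)) (0≤+ (0≤* (0≤∸ z≤a) (0≤sq (+ n - + 4 * y t)))
                                      (0≤* (0≤deg I t) (0≤sq (+ 4 * b - + 4 * y t - + n))))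
        where
        z≤a : z t ≤ a
        z≤a = subst (z t ≤_) (#N v) (deg≤# I t)
      expand : ∀ n a b c y z → c * ((a - z) * ((n - + 4 * y) * (n - + 4 * y)) + z * ((+ 4 * b - + 4 * y - n) * (+ 4 * b - + 4 * y - n)))
        ≡ (a * (n * n) * c + (- (+ 8 * a * n)) * (y * c) + + 16 * a * (c * (y * y)))
          + (+ 8 * (+ 2 * b - n) * b * (z * c) + (- (+ 16 * (+ 2 * b - n))) * (c * (y * z)))
      expand = solve-∀
      total : sum term ≡ (a * (+ n * + n) * b + (- (+ 8 * a * + n)) * Y + + 16 * a * S₂)
        + (+ 8 * (+ 2 * b - + n) * b * D v + (- (+ 16 * (+ 2 * b - + n))) * Q)
      total = trans (sum-cong-≗ λ t → expand (+ n) a b (χ J t) (y t) (z t))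
        (trans (∑-distrib-+ (λ t → a * (+ n * + n) * χ J t + (- (+ 8 * a * + n)) * (y t * χ J t) + + 16 * a * (χ J t * (y t * y t)))
                            (λ t → + 8 * (+ 2 * b - + n) * b * (z t * χ J t) + (- (+ 16 * (+ 2 * b - + n))) * (χ J t * (y t * z t))))
        (cong₂ _+_
          (trans (sum-lin₃ (a * (+ n * + n)) (- (+ 8 * a * + n)) (+ 16 * a) (χ J) (λ t → y t * χ J t) (λ t → χ J t * (y t * y t)))
            (cong₂ (λ m x → a * (+ n * + n) * m + (- (+ 8 * a * + n)) * x + + 16 * a * S₂) #J E-JJ))
          (trans (sum-lin₂ (+ 8 * (+ 2 * b - + n) * b) (- (+ 16 * (+ 2 * b - + n))) (λ t → z t * χ J t) (λ t → χ J t * (y t * z t)))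
            (cong (λ x → + 8 * (+ 2 * b - + n) * b * x + (- (+ 16 * (+ 2 * b - + n))) * Q) (trans (E-sym I J) E-IJ)))))
      moments : 0ℤ ≤ (a * (+ n * + n) * b + (- (+ 8 * a * + n)) * Y + + 16 * a * S₂)
        + (+ 8 * (+ 2 * b - + n) * b * D v + (- (+ 16 * (+ 2 * b - + n))) * Q)
      moments = subst (0ℤ ≤_) total (sum-0≤ 0≤term)
      cert : ∀ n a b Y D S Q →
        (a * (n * n) * b + (- (+ 8 * a * n)) * Y + + 16 * a * S) + (+ 8 * (+ 2 * b - n) * b * D + (- (+ 16 * (+ 2 * b - n))) * Q)
        + + 8 * a * (b * Y - + 2 * S) + + 8 * (n - + 2 * b) * (a * Y - + 2 * Q)
        ≡ b * (a * (n * n)) - b * (+ 8 * a * Y + + 8 * (n - + 2 * b) * D)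
      cert = solve-∀

    -- The complement of S lies in N(v) and spans no edge, so only 24(Y + 2(q/a)D) ≤ n² is at stake,
    -- up to the sampling error. Four times `moment-bound` minus a times the density hypothesis,
    -- read as 3n² ≤ 8(Y + 2D), is exactly this, since 32(n - 2b) - 16a = 48q.
    outside-N : + 2 * + n ≤ + 3 * a → + 3 * (+ n * + n) ≤ + 8 * M → ∃ Balanced
    outside-N 2n≤3a dense = build (sample 0<r n≤r² I ∣ q ∣ (subst (0ℤ <_) (sym (#N v)) 0<a)
        (subst₂ _≤_ (sym q≡) (sym (#N v)) q≤a))
      where
      q = + h - b
      n≤3a : + n ≤ + 3 * a
      n≤3a = ≤-from _ (0≤+ (0≤∸ 2n≤3a) (0≤+n {n})) (lem (+ n) a)
        where
        lem : ∀ n a → + 3 * a - + 2 * n + n ≡ + 3 * a - n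
        lem = solve-∀
      0<a = 0<third n≤3a
      0≤q : 0ℤ ≤ q
      0≤q = *-cancelˡ-≤ (+ 3) (0<+ {2}) (≤-from _ (0≤+ (0≤∸ 2n≤3a) (0≤-zero (- 1ℤ) n≡3h)) (lem (+ n) (+ h) a))
        where
        lem : ∀ n h a → + 3 * a - + 2 * n + - 1ℤ * (n - + 3 * h) ≡ + 3 * (h - (n - a)) - + 3 * 0ℤ
        lem = solve-∀
      q≡ : + ∣ q ∣ ≡ q
      q≡ = 0≤i⇒+∣i∣≡i 0≤q
      q≤a : q ≤ a
      q≤a = ≤-from _ (0≤+ (0≤* (0≤+n {2}) (0≤+n {h})) (0≤-zero 1ℤ n≡3h)) (lem (+ n) (+ h) a)
        where
        lem : ∀ n h a → + 2 * h + 1ℤ * (n - + 3 * h) ≡ a - (h - (n - a))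
        lem = solve-∀
      2b≤n : + 2 * b ≤ + n
      2b≤n = *-cancelˡ-≤ (+ 3) (0<+ {2}) (≤-from _ (0≤+ (0≤* (0≤+n {2}) (0≤∸ 2n≤3a)) (0≤+n {n})) (lem (+ n) a))
        where
        lem : ∀ n a → + 2 * (+ 3 * a - + 2 * n) + n ≡ + 3 * n - + 3 * (+ 2 * (n - a))
        lem = solve-∀
      cert : ∀ n h a D M X K → let b = n - a; q = h - b; Y = M - + 2 * D in
        + 48 * (q * D + a * K - a * X) + + 4 * (a * (n * n) - (+ 8 * a * Y + + 8 * (n - + 2 * b) * D))
          + a * (+ 8 * M - + 3 * (n * n)) + + 48 * a * K + (+ 16 * D) * (n - + 3 * h)
        ≡ a * (n * n + + 96 * K) - a * (+ 24 * (Y + + 2 * X + 0ℤ))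
      cert = solve-∀
      build : (∃ λ Q → # Q ≡ + ∣ q ∣ × Sample I Q) → ∃ Balanced
      build (Q , #Q′ , s) = J ∪ Q
        , trans (#-∪ disj) (trans (cong₂ _+_ #J (trans #Q′ q≡)) (lem b (+ h)))
        , *-cancelˡ-≤ a 0<a (subst (λ z → a * (+ 24 * z) ≤ a * (+ n * + n + + 96 * K)) (sym ESS)
            (≤-from _ (0≤+ (0≤+ (0≤+ (0≤+ (0≤* (0≤+n {48}) (0≤∸ fact)) (0≤* (0≤+n {4}) (0≤∸ (moment-bound 2b≤n))))
                (0≤* (<⇒≤ 0<a) (0≤∸ dense))) (0≤* (0≤* (0≤+n {48}) (<⇒≤ 0<a)) 0≤K′)) (0≤-zero (+ 16 * D v) n≡3h))
              (cert (+ n) (+ h) a (D v) M (E Q J) K)))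
        , subst (λ z → + 6 * z ≤ + n * + n + + 12 * K) (sym ES̄S̄) (0≤+ (0≤sq (+ n)) (0≤* (0≤+n {12}) 0≤K′))
        where
        open Sample s
        lem : ∀ b h → b + (h - b) ≡ h
        lem = solve-∀
        disj : ∀ u → J u ≡ true → Q u ≡ false
        disj u Ju with Q u in Qu
        ... | false = refl
        ... | true  = contradiction (trans (sym (P⊆X u Qu)) (proj₂ (∈-∖ {full} {I} u Ju))) λ ()
        EQQ : E Q Q ≡ 0ℤ
        EQQ = ≤-antisym (subst (E Q Q ≤_) (N-independent v) (E-mono-inner P⊆X)) (0≤E Q Q)
        ESS : E (J ∪ Q) (J ∪ Q) ≡ Y + + 2 * E Q J + 0ℤ
        ESS = trans (E-inner-∪ disj) (cong₂ (λ y z → y + + 2 * E Q J + z) E-JJ EQQ)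
        rest⊆I : (full ∖ (J ∪ Q)) ⊆ I
        rest⊆I u eq with I u | Q u
        ... | true | _ = refl
        ES̄S̄ : E (full ∖ (J ∪ Q)) (full ∖ (J ∪ Q)) ≡ 0ℤ
        ES̄S̄ = ≤-antisym (subst (E (full ∖ (J ∪ Q)) (full ∖ (J ∪ Q)) ≤_) (N-independent v) (E-mono-inner rest⊆I))
          (0≤E (full ∖ (J ∪ Q)) (full ∖ (J ∪ Q)))
        fact : a * E Q J ≤ q * D v + a * K
        fact = subst (λ x → a * E Q J ≤ q * x + a * K) (trans (E-sym I J) E-IJ)
          (subst₂ (λ m t → m * E Q J ≤ t * E I J + m * K) (#N v) (trans #Q′ q≡) (upper J))

  balanced : ∃ Balanced
  balanced with + 8 * M ≤? + 3 * (+ n * + n)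
  ... | yes few = sparse few
  ... | no  many with any? (λ v → + 2 * + n ≤? + 3 * d v)
  ...   | yes (v , high) = At.outside-N v high (<⇒≤ (≰⇒> many))
  ...   | no  none = choose (exists-good 0<n)
    where
    U = + n * + n - + 2 * M
    dense : + 3 * (+ n * + n) ≤ + 8 * M
    dense = <⇒≤ (≰⇒> many)
    3d≤2n : ∀ u → + 3 * d u ≤ + 2 * + n
    3d≤2n u = <⇒≤ (≰⇒> λ le → none (u , le))
    3D≤2nd : ∀ v → + 3 * D v ≤ + 2 * + n * d v
    3D≤2nd v = begin
      + 3 * sum (λ u → d u * A v u)      ≡⟨ *-distribˡ-sum (+ 3) (λ u → d u * A v u) ⟩
      sum (λ u → + 3 * (d u * A v u))    ≤⟨ sum-mono bound ⟩
      sum (λ u → + 2 * + n * A v u)      ≡⟨ *-distribˡ-sum (+ 2 * + n) (λ u → A v u) ⟨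
      + 2 * + n * # (N v)                ≡⟨ cong (_*_ (+ 2 * + n)) (#N v) ⟩
      + 2 * + n * d v                    ∎
      where
      open ≤-Reasoning
      lem : ∀ x y a → a * (x - + 3 * y) ≡ x * a - + 3 * (y * a)
      lem = solve-∀
      bound : ∀ u → + 3 * (d u * A v u) ≤ + 2 * + n * A v u
      bound u = ≤-from _ (0≤* (0≤ι (adj G v u)) (0≤∸ (3d≤2n u))) (lem (+ 2 * + n) (d u) (A v u))
    0≤U : 0ℤ ≤ U
    0≤U = 0≤∸ (mantel 0<n)
    4U≤n² : + 4 * U ≤ + n * + n
    4U≤n² = ≤-from _ (0≤∸ dense) (lem (+ n * + n) M)
      where
      lem : ∀ s m → + 8 * m - + 3 * s ≡ s - + 4 * (s - + 2 * m)
      lem = solve-∀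
    choose : (∃ λ v → gap (+ n) U (d v) (D v) ≤ 0ℤ) → ∃ Balanced
    choose (v , gap≤0) with + n ≤? + 3 * d v | + 4 * (+ n * + n) - U ≤? + 16 * + n * d v
    ... | yes high | _ = At.inside-N v high (subst (λ z → d v * z ≤ + 4 * + n * D v) (lem (+ n * + n) M) (gap-high {d = d v} 0<n 0≤U 4U≤n² gap≤0))
      where
      lem : ∀ s m → + 2 * s - + 3 * (s - + 2 * m) ≡ + 6 * m - s
      lem = solve-∀
    ... | no low | no very-low = ⊥-elim (gap-low {d = d v} 0<n 0≤U 4U≤n² gap≤0 (3D≤2nd v) (≰⇒> very-low))
    ... | no low | yes not-too-low = At.around-N v (At.0<b v) 0≤h-d
        (subst (_≤ + 16 * D v) (lem₁ (+ n * + n) M ((+ n - d v) * (+ n - d v))) (gap-middle {d = d v} 0<n 0≤U 4U≤n² gap≤0))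
        (subst (_≤ + 3 * (+ n * + n) * ((+ n - d v) * (+ n - d v))) (lem₂ (+ n) M ((+ n - + 3 * d v) * (+ n - + 3 * d v)) (+ 32 * + n * (+ n - + 3 * d v) * D v))
          (low-degree-bound 0<n 4U≤n² (<⇒≤ (≰⇒> low)) not-too-low (3D≤2nd v)))
      where
      lem₁ : ∀ s m c → + 4 * s - + 4 * (s - + 2 * m) - + 3 * c ≡ + 8 * m - + 3 * c
      lem₁ = solve-∀
      lem₂ : ∀ n m t x → + 4 * t * (n * n - (n * n - + 2 * m)) + x ≡ + 8 * t * m + x
      lem₂ = solve-∀
      lem₃ : ∀ n h a → (n - + 3 * a) + - 1ℤ * (n - + 3 * h) ≡ + 3 * (h - a) - + 3 * 0ℤ
      lem₃ = solve-∀
      0≤h-d : 0ℤ ≤ + h - d v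
      0≤h-d = *-cancelˡ-≤ (+ 3) (0<+ {2}) (≤-from _ (0≤+ (0≤∸ (<⇒≤ (≰⇒> low))) (0≤-zero (- 1ℤ) n≡3h)) (lem₃ (+ n) (+ h) (d v)))

-- Partitions

length-filter : ∀ {n} {A : Set} (S : A → Bool) (f : Fin n → A) →
  + length (filterᵇ S (tabulate f)) ≡ sum (λ i → ι (S (f i)))
length-filter {zero}  S f = refl
length-filter {suc n} S f with S (f zero)
... | true  = cong (_+_ 1ℤ) (length-filter S (λ i → f (suc i)))
... | false = trans (length-filter S (λ i → f (suc i))) (sym (+-identityˡ _))

sum-tabulate : ∀ {n} {A : Set} (g : A → ℕ) (f : Fin n → A) →
  + List.sum (map g (tabulate f)) ≡ sum (λ i → + g (f i))
sum-tabulate {zero}  g f = refl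
sum-tabulate {suc n} g f = cong (_+_ (+ g (f zero))) (sum-tabulate g (λ i → f (suc i)))

card≡# : ∀ {n} (S : Subset n) → + card S ≡ # S
card≡# S = length-filter S (λ i → i)

module _ {n : ℕ} (G : Graph n) where
  open Edges G

  -- Ordered pairs split into i < j, i > j and the diagonal; the first two count alike by symmetry,
  -- and irreflexivity empties the third.
  2e≡E : ∀ S → + 2 * + e G S ≡ E S S
  2e≡E S = begin
    + 2 * + e G S                                                     ≡⟨ cong (_*_ (+ 2)) (trans (sum-tabulate (λ i → card (λ j → below i j)) (λ i → i)) (sum-cong-≗ λ i → card≡# (λ j → below i j))) ⟩
    + 2 * sum (λ i → sum (λ j → ι (below i j)))                       ≡⟨ lem (sum (λ i → sum (λ j → ι (below i j)))) ⟩
    sum (λ i → sum (λ j → ι (below i j))) + sum (λ i → sum (λ j → ι (below i j)))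
      ≡⟨ cong (_+_ (sum (λ i → sum (λ j → ι (below i j))))) (∑-comm (λ i j → ι (below i j))) ⟩
    sum (λ i → sum (λ j → ι (below i j))) + sum (λ i → sum (λ j → ι (below j i)))
      ≡⟨ ∑-distrib-+ (λ i → sum (λ j → ι (below i j))) (λ i → sum (λ j → ι (below j i))) ⟨
    sum (λ i → sum (λ j → ι (below i j)) + sum (λ j → ι (below j i)))
      ≡⟨ sum-cong-≗ (λ i → trans (sym (∑-distrib-+ (λ j → ι (below i j)) (λ j → ι (below j i)))) (sum-cong-≗ (both i))) ⟩
    sum (λ i → sum (λ j → χ S i * (χ S j * A j i)))                   ≡⟨ sum-cong-≗ (λ i → trans (sym (*-distribˡ-sum (χ S i) (λ j → χ S j * A j i))) (*-comm (χ S i) (deg S i))) ⟩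
    E S S                                                             ∎
    where
    open ≡-Reasoning
    lem : ∀ x → + 2 * x ≡ x + x
    lem = solve-∀
    below : Fin n → Fin n → Bool
    below i j = (toℕ i ℕ.<ᵇ toℕ j) ∧ S i ∧ S j ∧ adj G i j
    ι-∧ : ∀ a b c → ι (a ∧ b ∧ c) ≡ ι a * (ι b * ι c)
    ι-∧ true  true  true  = refl
    ι-∧ true  true  false = refl
    ι-∧ true  false _     = refl
    ι-∧ false _     _     = refl
    swap : ∀ x y z → x * (y * z) ≡ y * (x * z)
    swap = solve-∀
    both : ∀ i j → ι (below i j) + ι (below j i) ≡ χ S i * (χ S j * A j i)
    both i j with toℕ i ℕ.<ᵇ toℕ j in ij | toℕ j ℕ.<ᵇ toℕ i in ji
    ... | true  | true  = contradiction (ℕ.<ᵇ⇒< _ _ (subst Bool.T (sym ij) _)) (ℕ.<-asym (ℕ.<ᵇ⇒< (toℕ j) (toℕ i) (subst Bool.T (sym ji) _)))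
    ... | true  | false = trans (+-identityʳ _) (trans (ι-∧ (S i) (S j) (adj G i j)) (cong (λ a → χ S i * (χ S j * a)) (A-sym i j)))
    ... | false | true  = trans (+-identityˡ _) (trans (ι-∧ (S j) (S i) (adj G j i)) (swap (χ S j) (χ S i) (A j i)))
    ... | false | false with toℕ-injective {i = i} {j} (ℕ.≤-antisym (ℕ.≮⇒≥ λ lt → subst Bool.T ji (ℕ.<⇒<ᵇ lt)) (ℕ.≮⇒≥ λ lt → subst Bool.T ij (ℕ.<⇒<ᵇ lt)))
    ...   | refl rewrite adj-irrefl G i = sym (trans (cong (_*_ (χ S i)) (*-zeroʳ (χ S i))) (*-zeroʳ (χ S i)))

-- Rounded-up square roots and the error term

⌈√_⌉ : ℕ → ℕ
⌈√ zero ⌉ = 0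
⌈√ suc n ⌉ with suc n ℕ.≤? ⌈√ n ⌉ ℕ.* ⌈√ n ⌉
... | yes _ = ⌈√ n ⌉
... | no  _ = suc ⌈√ n ⌉

⌈√⌉-lower : ∀ n → n ℕ.≤ ⌈√ n ⌉ ℕ.* ⌈√ n ⌉
⌈√⌉-lower zero = z≤n
⌈√⌉-lower (suc n) with suc n ℕ.≤? ⌈√ n ⌉ ℕ.* ⌈√ n ⌉
... | yes le = le
... | no  _  = s≤s (ℕ.≤-trans (⌈√⌉-lower n) (ℕ.≤-trans (ℕ.*-monoʳ-≤ ⌈√ n ⌉ (ℕ.n≤1+n ⌈√ n ⌉)) (ℕ.m≤n+m _ ⌈√ n ⌉)))

⌈√⌉-upper : ∀ n → ⌈√ n ⌉ ℕ.* ⌈√ n ⌉ ℕ.≤ n ℕ.+ 2 ℕ.* ⌈√ n ⌉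
⌈√⌉-upper zero = z≤n
⌈√⌉-upper (suc n) with suc n ℕ.≤? ⌈√ n ⌉ ℕ.* ⌈√ n ⌉
... | yes _ = ℕ.m≤n⇒m≤1+n (⌈√⌉-upper n)
... | no gt = s≤s (begin
  r ℕ.+ r ℕ.* suc r            ≡⟨ lem r ⟩
  r ℕ.* r ℕ.+ 2 ℕ.* r          ≤⟨ ℕ.+-mono-≤ (ℕ.s≤s⁻¹ (ℕ.≰⇒> gt)) (ℕ.*-monoʳ-≤ 2 (ℕ.n≤1+n r)) ⟩
  n ℕ.+ 2 ℕ.* suc r            ∎)
  where
  open ℕ.≤-Reasoning
  r = ⌈√ n ⌉
  lem : ∀ r → r ℕ.+ r ℕ.* suc r ≡ r ℕ.* r ℕ.+ 2 ℕ.* r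
  lem = ℕR.solve-∀

-- The 2 in c + 2 absorbs the excess 2r of r² over n in `⌈√⌉-upper`.
⌈√⌉-small : ∀ c n → (c ℕ.+ 2) ℕ.* (c ℕ.+ 2) ℕ.≤ n → c ℕ.* ⌈√ n ⌉ ℕ.≤ n
⌈√⌉-small c n large = ℕ.+-cancelʳ-≤ (2 ℕ.* r) (c ℕ.* r) n (begin
  c ℕ.* r ℕ.+ 2 ℕ.* r  ≡⟨ ℕ.*-distribʳ-+ r c 2 ⟨
  (c ℕ.+ 2) ℕ.* r      ≤⟨ ℕ.*-monoˡ-≤ r c+2≤r ⟩
  r ℕ.* r              ≤⟨ ⌈√⌉-upper n ⟩
  n ℕ.+ 2 ℕ.* r        ∎)
  where
  open ℕ.≤-Reasoning
  r = ⌈√ n ⌉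
  c+2≤r : c ℕ.+ 2 ℕ.≤ r
  c+2≤r = ℕ.≮⇒≥ λ r<c+2 → ℕ.<-irrefl refl (ℕ.<-≤-trans (ℕ.*-mono-< r<c+2 r<c+2) (ℕ.≤-trans large (⌈√⌉-lower n)))

-- Twice the deviation K for r = `⌈√ n ⌉`, that is, 96K divided by 48.
error : ℕ → ℕ
error n = 2 ℕ.* (n ℕ.* ⌈√ n ⌉)

error-littleO : LittleOSquare error
error-littleO k = (c ℕ.+ 2) ℕ.* (c ℕ.+ 2) , λ n large → ℕ.≤-trans (ℕ.≤-reflexive (lem (suc k) n ⌈√ n ⌉)) (ℕ.*-monoʳ-≤ n (⌈√⌉-small c n large))
  where
  c = 2 ℕ.* suc k
  lem : ∀ k n r → k ℕ.* (2 ℕ.* (n ℕ.* r)) ≡ n ℕ.* (2 ℕ.* k ℕ.* r)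
  lem = ℕR.solve-∀

⌈√⌉>0 : ∀ n → 0 ℕ.< n → 0 ℕ.< ⌈√ n ⌉
⌈√⌉>0 n 0<n = ℕ.≰⇒> λ r≤0 → ℕ.<-irrefl refl (ℕ.<-≤-trans 0<n (ℕ.≤-trans (⌈√⌉-lower n) (ℕ.*-monoˡ-≤ ⌈√ n ⌉ r≤0)))

-- Assembling the equipartition

module Partition {n h : ℕ} (n≡ : n ≡ h ℕ.* 3) (0<n : 0 ℕ.< n) (G : Graph n) (tf : TriangleFree G) where

  private
    n≡3h : + n ≡ + 3 * + h
    n≡3h = trans (cong +_ (trans n≡ (ℕ.*-comm h 3))) (pos-* 3 h)

    n≤r² : + n ≤ + ⌈√ n ⌉ * + ⌈√ n ⌉
    n≤r² = subst (+ n ≤_) (pos-* ⌈√ n ⌉ ⌈√ n ⌉) (+≤+ (⌈√⌉-lower n))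

    0<r : 0ℤ < + ⌈√ n ⌉
    0<r = +<+ (⌈√⌉>0 n 0<n)

  open Balancing G tf h n≡3h (+<+ 0<n) (+ ⌈√ n ⌉) 0<r n≤r²

  module Halve {S : Subset n} (#S : # S ≡ + h) (inner : + 6 * E (full ∖ S) (full ∖ S) ≤ + n * + n + + 12 * K) where

    X : Subset n
    X = full ∖ S

    #X : # X ≡ + 2 * + h
    #X = trans (#-∖ {P = S} {full} ⊆-full) (trans (cong₂ _-_ (trans (#-full {n}) n≡3h) #S) (lem (+ h)))
      where
      lem : ∀ h → + 3 * h - h ≡ + 2 * h
      lem = solve-∀

    0<h : 0ℤ < + h
    0<h = *-cancelˡ-<-nonNeg (+ 3) (subst (0ℤ <_) n≡3h (+<+ 0<n))

    -- Half of X carries a quarter of its edges up to sampling error, so 24 E P P is at most 6 E X X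
    -- + 48K, and `inner` turns this into n² + 60K. The remaining 36K is slack, given away to match
    -- the bound for S.
    half-bound : ∀ {P} → # P ≡ + h → Sample X P → + 24 * E P P ≤ + n * + n + + 96 * K
    half-bound {P} #P s = *-cancelˡ-≤ (+ 4 * (+ h * + h)) (0<* (0<+ {3}) (0<* 0<h 0<h)) (≤-from _
      (0≤+ (0≤+ (0≤* (0≤+n {24}) (0≤∸ fact)) (0≤* (0≤* (0≤+n {4}) (0≤sq (+ h))) (0≤∸ inner))) (0≤* (0≤* (0≤+n {144}) (0≤sq (+ h))) (0≤K 0<r n≤r²)))
      (lem (+ n) (+ h) (E P P) (E X X) K))
      where
      fact : + 2 * + h * (+ 2 * + h) * E P P ≤ + h * + h * E X X + + 2 * (+ 2 * + h * (+ 2 * + h) * K)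
      fact = subst₂ (λ m t → m * m * E P P ≤ t * t * E X X + + 2 * (m * m * K)) #X #P (Sample-inner (0≤K 0<r n≤r²) s)
      lem : ∀ n h p x k → + 24 * (h * h * x + + 2 * (+ 2 * h * (+ 2 * h) * k) - + 2 * h * (+ 2 * h) * p)
        + + 4 * (h * h) * (n * n + + 12 * k - + 6 * x) + + 144 * (h * h) * k
        ≡ + 4 * (h * h) * (n * n + + 96 * k) - + 4 * (h * h) * (+ 24 * p)
      lem = solve-∀

    halves : ∃ λ P → # P ≡ + h × Sample X P
    halves = sample 0<r n≤r² X h (subst (0ℤ <_) (sym #X) (0<* (0<+ {1}) 0<h)) (subst (+ h ≤_) (sym #X)
      (≤-from _ (0≤+n {h}) (lem (+ h))))
      where
      lem : ∀ h → h ≡ + 2 * h - h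
      lem = solve-∀

  Part : Subset n → Set
  Part S = # S ≡ + h × + 24 * E S S ≤ + n * + n + + 96 * K

  Part-sound : ∀ {S S′ : Subset n} → (∀ v → S′ v ≡ S v) → Part S →
    3 ℕ.* card S′ ≡ n × 48 ℕ.* e G S′ ℕ.≤ n ℕ.* n ℕ.+ 48 ℕ.* error n
  Part-sound {S} {S′} eq (#S , few) = size , drop‿+≤+ (subst₂ _≤_ left right few)
    where
    size : 3 ℕ.* card S′ ≡ n
    size = trans (cong (3 ℕ.*_) (+-injective (trans (card≡# S′) (trans (sum-cong-≗ λ v → cong ι (eq v)) #S)))) (trans (ℕ.*-comm 3 h) (sym n≡))
    left : + 24 * E S S ≡ + (48 ℕ.* e G S′)
    left = trans (cong (_*_ (+ 24)) (trans (E-cong λ v → sym (eq v)) (sym (2e≡E G S′))))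
      (trans (lem (+ e G S′)) (sym (pos-* 48 (e G S′))))
      where
      lem : ∀ x → + 24 * (+ 2 * x) ≡ + 48 * x
      lem = solve-∀
    right : + n * + n + + 96 * K ≡ + (n ℕ.* n ℕ.+ 48 ℕ.* error n)
    right = trans (cong₂ _+_ (sym (pos-* n n)) (trans (cong (_*_ (+ 96)) (sym (pos-* n ⌈√ n ⌉)))
      (trans (sym (pos-* 96 (n ℕ.* ⌈√ n ⌉))) (cong +_ (lem n ⌈√ n ⌉))))) (sym (pos-+ (n ℕ.* n) (48 ℕ.* error n)))
      where
      lem : ∀ n r → 96 ℕ.* (n ℕ.* r) ≡ 48 ℕ.* (2 ℕ.* (n ℕ.* r))
      lem = ℕR.solve-∀

  Equipartition : (Fin n → Fin 3) → Set
  Equipartition p = (∀ k → 3 ℕ.* card (part p k) ≡ n)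
    × (∀ k → 48 ℕ.* e G (part p k) ℕ.≤ n ℕ.* n ℕ.+ 48 ℕ.* error n)

  equipartition : ∃ Equipartition
  equipartition = first balanced
    where
    first : ∃ Balanced → ∃ Equipartition
    first (S , #S , few , inner) = second halves
      where
      open Halve #S inner
      second : (∃ λ P → # P ≡ + h × Sample X P) → ∃ Equipartition
      second (P , #P , s) = p , (λ k → proj₁ (sound k)) , (λ k → proj₂ (sound k))
        where
        open Sample s
        p : Fin n → Fin 3
        p v = if S v then zero else if P v then suc zero else suc (suc zero)
        #Q : # (X ∖ P) ≡ + h
        #Q = trans (#-∖ P⊆X) (trans (cong₂ _-_ #X #P) (lem (+ h)))
          where
          lem : ∀ h → + 2 * h - h ≡ h
          lem = solve-∀
        part₀ : ∀ v → part p zero v ≡ S v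
        part₀ v with S v | P v
        ... | true  | _     = refl
        ... | false | true  = refl
        ... | false | false = refl
        part₁ : ∀ v → part p (suc zero) v ≡ P v
        part₁ v with S v in Sv | P v in Pv
        ... | true  | true  = contradiction (trans (sym Sv) (proj₂ (∈-∖ {full} {S} v (P⊆X v Pv)))) λ ()
        ... | true  | false = refl
        ... | false | true  = refl
        ... | false | false = refl
        part₂ : ∀ v → part p (suc (suc zero)) v ≡ (X ∖ P) v
        part₂ v with S v | P v
        ... | true  | _     = refl
        ... | false | true  = refl
        ... | false | false = refl
        sound : ∀ k → 3 ℕ.* card (part p k) ≡ n × 48 ℕ.* e G (part p k) ℕ.≤ n ℕ.* n ℕ.+ 48 ℕ.* error n
        sound zero             = Part-sound part₀ (#S , few)
        sound (suc zero)       = Part-sound part₁ (#P , half-bound #P s)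
        sound (suc (suc zero)) = Part-sound part₂ (#Q , half-bound #Q (complement s))

theorem1p9 : Σ (ℕ → ℕ) λ g → LittleOSquare g ×
    (∀ n → 3 ∣ n → (G : Graph n) → TriangleFree G →
    ∃ λ (p : Fin n → Fin 3) →
    (∀ k → 3 ℕ.* card (part p k) ≡ n) ×
    (∀ k → 48 ℕ.* e G (part p k) ℕ.≤ n ℕ.* n ℕ.+ 48 ℕ.* g n))
theorem1p9 = error , error-littleO , partition
  where
  partition : ∀ n → 3 ∣ n → (G : Graph n) → TriangleFree G → _
  -- The cancellations need n > 0, so the empty graph is treated apart.
  partition zero    _             G tf = (λ ()) , (λ _ → refl) , (λ _ → z≤n)
  partition (suc n) (divides h eq) G tf = Partition.equipartition {h = h} eq (s≤s z≤n) G tf
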